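{- For every integer $k\ge 1$ there is a constant $C_k$ such that for every $n\ge 1$ the number of Viterbi sequences of length $n$ for $k$-state Markov chains, counted up to equivalence, is at most $C_k$. That is, for fixed $k$ the number of Viterbi sequences of length $n$ remains bounded as $n\to\infty$.
   Context: A $k$-state Markov chain has states $0,1,\dots,k-1$, an initial distribution $(\pi_i)$ and a stochastic transition matrix $(p_{ij})$. The space $\mathcal M_k$ of all such chains is a product of $k+1$ simplices of dimension $k-1$, hence has dimension $(k+1)(k-1)$, and carries Lebesgue measure. A sequence of length $n$ is a sequence of states $s_0s_1\cdots s_n$ (with $n$ transitions); its probability is $\Pr[s_0\cdots s_n]=\pi_{s_0}\prod_{t=1}^n p_{s_{t-1}s_t}$. A Viterbi path of length $n$ of a Markov chain is a sequence of length $n$ of maximal probability. Two Markov chains are in the same region (for given $n$) iff they have the same set of Viterbi paths of length $n$; a Viterbi region is a region of positive measure in $\mathcal M_k$. A Viterbi sequence of length $n$ is a sequence that is a Viterbi path for (the chains of) some Viterbi region. Two sequences of the same length are equivalent if they have the same initial state and the same multiset of transitions $(s_{t-1},s_t)$; Viterbi sequences are counted up to equivalence (one sequence represents its whole class). -}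

module Defs where

open import Data.Fin.Base using (Fin; zero; suc; remQuot)
open import Data.List.Base using (List; []; _∷_; length; map; foldr)
open import Data.List.Relation.Binary.Permutation.Propositional using (_↭_)
open import Data.List.Relation.Unary.All using (All)
open import Data.List.Relation.Unary.AllPairs using (AllPairs)
open import Data.Maybe.Base using (Maybe; maybe)
open import Data.Maybe.Relation.Unary.Any using (Any)
open import Data.Nat.Base as ℕ using (ℕ; zero; suc)
import Data.Nat.Properties as ℕ
open import Data.Product.Base using (_×_; _,_; ∃-syntax; uncurry)
open import Data.Rational.Base as ℚ using (ℚ; 0ℚ; 1ℚ; ½; ∣_∣; 1/_; Positive)
import Data.Rational.Properties as ℚ
open import Data.Rational.Solver using (module +-*-Solver)
open import Data.Vec.Base using (Vec; []; _∷_; head)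
open import Data.Vec.Functional as Vector using (Vector)
open import Function.Bundles using (_⇔_)
open import Relation.Binary.PropositionalEquality using (_≡_; refl; sym; trans; cong; cong₂; subst)
open import Relation.Nullary.Negation.Core using (¬_)

------------------------------------------------------------------------
-- Real numbers: Cauchy sequences of rationals, with setoid equality _≈_

IsCauchy : (ℕ → ℚ) → Set
IsCauchy x = ∀ ε → 0ℚ ℚ.< ε →
  ∃[ N ] (∀ m n → N ℕ.≤ m → N ℕ.≤ n → ∣ x m ℚ.- x n ∣ ℚ.≤ ε)

record ℝ : Set where
  constructor mkℝ
  field
    approx : ℕ → ℚ
    cauchy : IsCauchy approx

open ℝ public

infix 4 _≈_ _≤_

_≈_ : ℝ → ℝ → Set
x ≈ y = ∀ ε → 0ℚ ℚ.< ε →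
  ∃[ N ] (∀ n → N ℕ.≤ n → ∣ approx x n ℚ.- approx y n ∣ ℚ.≤ ε)

_≤_ : ℝ → ℝ → Set
x ≤ y = ∀ ε → 0ℚ ℚ.< ε →
  ∃[ N ] (∀ n → N ℕ.≤ n → approx x n ℚ.≤ approx y n ℚ.+ ε)

fromℚ : ℚ → ℝ
fromℚ q = mkℝ (λ _ → q) λ ε 0<ε → 0 , λ _ _ _ _ →
  subst (λ p → ∣ p ∣ ℚ.≤ ε) (sym (ℚ.+-inverseʳ q)) (ℚ.<⇒≤ 0<ε)

0ℝ 1ℝ : ℝ
0ℝ = fromℚ 0ℚ
1ℝ = fromℚ 1ℚ

private abstract
  half-pos : ∀ {ε} → 0ℚ ℚ.< ε → 0ℚ ℚ.< ½ ℚ.* ε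
  half-pos {ε} 0<ε = ℚ.positive⁻¹ (½ ℚ.* ε) {{ℚ.pos*pos⇒pos ½ ε {{ℚ.positive 0<ε}}}}

  halves : ∀ ε → ½ ℚ.* ε ℚ.+ ½ ℚ.* ε ≡ ε
  halves ε = trans (sym (ℚ.*-distribʳ-+ ε ½ ½)) (ℚ.*-identityˡ ε)

  +-cauchy : ∀ {x y} → IsCauchy x → IsCauchy y → IsCauchy (λ n → x n ℚ.+ y n)
  +-cauchy {x} {y} cx cy ε 0<ε with cx _ (half-pos 0<ε) | cy _ (half-pos 0<ε)
  ... | N₁ , p | N₂ , q = N₁ ℕ.⊔ N₂ , λ m n N≤m N≤n → begin
      ∣ (x m ℚ.+ y m) ℚ.- (x n ℚ.+ y n) ∣
        ≡⟨ cong ∣_∣ (regroup (x m) (y m) (x n) (y n)) ⟩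
      ∣ (x m ℚ.- x n) ℚ.+ (y m ℚ.- y n) ∣
        ≤⟨ ℚ.∣p+q∣≤∣p∣+∣q∣ (x m ℚ.- x n) (y m ℚ.- y n) ⟩
      ∣ x m ℚ.- x n ∣ ℚ.+ ∣ y m ℚ.- y n ∣
        ≤⟨ ℚ.+-mono-≤
             (p m n (ℕ.m⊔n≤o⇒m≤o N₁ N₂ N≤m) (ℕ.m⊔n≤o⇒m≤o N₁ N₂ N≤n))
             (q m n (ℕ.m⊔n≤o⇒n≤o N₁ N₂ N≤m) (ℕ.m⊔n≤o⇒n≤o N₁ N₂ N≤n)) ⟩
      ½ ℚ.* ε ℚ.+ ½ ℚ.* ε
        ≡⟨ halves ε ⟩
      ε ∎
    where
    open ℚ.≤-Reasoning
    regroup : ∀ a b c d → (a ℚ.+ b) ℚ.- (c ℚ.+ d) ≡ (a ℚ.- c) ℚ.+ (b ℚ.- d)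
    regroup = solve 4 (λ a b c d →
      (a :+ b) :- (c :+ d) := (a :- c) :+ (b :- d)) refl
      where open +-*-Solver

  eventually-bounded : ∀ {x} → IsCauchy x →
    ∃[ K ] (0ℚ ℚ.≤ K × ∃[ N ] (∀ n → N ℕ.≤ n → ∣ x n ∣ ℚ.≤ K))
  eventually-bounded {x} cx with cx 1ℚ (ℚ.positive⁻¹ 1ℚ)
  ... | N , p = 1ℚ ℚ.+ ∣ x N ∣
              , ℚ.+-mono-≤ (ℚ.nonNegative⁻¹ 1ℚ) (ℚ.0≤∣p∣ (x N))
              , N , λ n N≤n → begin
      ∣ x n ∣
        ≡⟨ cong ∣_∣ (split (x n) (x N)) ⟩
      ∣ (x n ℚ.- x N) ℚ.+ x N ∣
        ≤⟨ ℚ.∣p+q∣≤∣p∣+∣q∣ (x n ℚ.- x N) (x N) ⟩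
      ∣ x n ℚ.- x N ∣ ℚ.+ ∣ x N ∣
        ≤⟨ ℚ.+-monoˡ-≤ ∣ x N ∣ (p n N N≤n ℕ.≤-refl) ⟩
      1ℚ ℚ.+ ∣ x N ∣ ∎
    where
    open ℚ.≤-Reasoning
    split : ∀ a b → a ≡ (a ℚ.- b) ℚ.+ b
    split = solve 2 (λ a b → a := (a :- b) :+ b) refl
      where open +-*-Solver

  *-mono : ∀ {a b c d} → 0ℚ ℚ.≤ b → 0ℚ ℚ.≤ c → a ℚ.≤ b → c ℚ.≤ d → a ℚ.* c ℚ.≤ b ℚ.* d
  *-mono {b = b} {c} 0≤b 0≤c a≤b c≤d = ℚ.≤-trans
    (ℚ.*-monoʳ-≤-nonNeg c {{ℚ.nonNegative 0≤c}} a≤b)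
    (ℚ.*-monoˡ-≤-nonNeg b {{ℚ.nonNegative 0≤b}} c≤d)

  shrink : ∀ K ε → 0ℚ ℚ.< K → 0ℚ ℚ.< ε → ∃[ δ ] (0ℚ ℚ.< δ × K ℚ.* δ ≡ ε)
  shrink K ε 0<K 0<ε = K⁻¹ ℚ.* ε
    , ℚ.positive⁻¹ (K⁻¹ ℚ.* ε) {{ℚ.pos*pos⇒pos K⁻¹ {{ℚ.1/pos⇒pos K {{K-pos}}}} ε {{ℚ.positive 0<ε}}}}
    , trans (sym (ℚ.*-assoc K K⁻¹ ε))
        (trans (cong (ℚ._* ε) (ℚ.*-inverseʳ K {{ℚ.pos⇒nonZero K {{K-pos}}}})) (ℚ.*-identityˡ ε))
    where
    K-pos : Positive K
    K-pos = ℚ.positive 0<K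
    K⁻¹ : ℚ
    K⁻¹ = (1/ K) {{ℚ.pos⇒nonZero K {{K-pos}}}}

  product-diff : ∀ a b c d →
    ∣ a ℚ.* b ℚ.- c ℚ.* d ∣ ℚ.≤ ∣ a ∣ ℚ.* ∣ b ℚ.- d ∣ ℚ.+ ∣ d ∣ ℚ.* ∣ a ℚ.- c ∣
  product-diff a b c d = begin
      ∣ a ℚ.* b ℚ.- c ℚ.* d ∣
        ≡⟨ cong ∣_∣ (regroup a b c d) ⟩
      ∣ a ℚ.* (b ℚ.- d) ℚ.+ d ℚ.* (a ℚ.- c) ∣
        ≤⟨ ℚ.∣p+q∣≤∣p∣+∣q∣ (a ℚ.* (b ℚ.- d)) (d ℚ.* (a ℚ.- c)) ⟩
      ∣ a ℚ.* (b ℚ.- d) ∣ ℚ.+ ∣ d ℚ.* (a ℚ.- c) ∣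
        ≡⟨ cong₂ ℚ._+_ (ℚ.∣p*q∣≡∣p∣*∣q∣ a (b ℚ.- d)) (ℚ.∣p*q∣≡∣p∣*∣q∣ d (a ℚ.- c)) ⟩
      ∣ a ∣ ℚ.* ∣ b ℚ.- d ∣ ℚ.+ ∣ d ∣ ℚ.* ∣ a ℚ.- c ∣ ∎
    where
    open ℚ.≤-Reasoning
    regroup : ∀ a b c d →
      a ℚ.* b ℚ.- c ℚ.* d ≡ a ℚ.* (b ℚ.- d) ℚ.+ d ℚ.* (a ℚ.- c)
    regroup = solve 4 (λ a b c d →
      a :* b :- c :* d := a :* (b :- d) :+ d :* (a :- c)) refl
      where open +-*-Solver

  common-factor : ∀ K₁ K₂ {δ ε} → 0ℚ ℚ.≤ δ → (1ℚ ℚ.+ (K₁ ℚ.+ K₂)) ℚ.* δ ≡ ε →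
    K₁ ℚ.* δ ℚ.+ K₂ ℚ.* δ ℚ.≤ ε
  common-factor K₁ K₂ {δ} {ε} 0≤δ Kδ≡ε = begin
      K₁ ℚ.* δ ℚ.+ K₂ ℚ.* δ
        ≡⟨ sym (ℚ.*-distribʳ-+ δ K₁ K₂) ⟩
      (K₁ ℚ.+ K₂) ℚ.* δ
        ≤⟨ ℚ.*-monoʳ-≤-nonNeg δ {{ℚ.nonNegative 0≤δ}} (≤1+ (K₁ ℚ.+ K₂)) ⟩
      (1ℚ ℚ.+ (K₁ ℚ.+ K₂)) ℚ.* δ
        ≡⟨ Kδ≡ε ⟩
      ε ∎
    where
    open ℚ.≤-Reasoning
    ≤1+ : ∀ K → K ℚ.≤ 1ℚ ℚ.+ K
    ≤1+ K = subst (ℚ._≤ 1ℚ ℚ.+ K) (ℚ.+-identityˡ K) (ℚ.+-monoˡ-≤ K (ℚ.nonNegative⁻¹ 1ℚ))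

  *-cauchy : ∀ {x y} → IsCauchy x → IsCauchy y → IsCauchy (λ n → x n ℚ.* y n)
  *-cauchy {x} {y} cx cy ε 0<ε =
    let K₁ , 0≤K₁ , M₁ , b₁ = eventually-bounded {x} cx
        K₂ , 0≤K₂ , M₂ , b₂ = eventually-bounded {y} cy
        δ , 0<δ , Kδ≡ε = shrink (1ℚ ℚ.+ (K₁ ℚ.+ K₂)) ε
          (ℚ.+-mono-<-≤ (ℚ.positive⁻¹ 1ℚ) (ℚ.+-mono-≤ 0≤K₁ 0≤K₂)) 0<ε
        N₁ , p = cx δ 0<δ
        N₂ , q = cy δ 0<δ
        M = M₁ ℕ.⊔ M₂
        N = N₁ ℕ.⊔ N₂
    in M ℕ.⊔ N , λ m n h h′ →
      let M≤m = ℕ.m⊔n≤o⇒m≤o M N h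
          M≤n = ℕ.m⊔n≤o⇒m≤o M N h′
          N≤m = ℕ.m⊔n≤o⇒n≤o M N h
          N≤n = ℕ.m⊔n≤o⇒n≤o M N h′
      in ℚ.≤-trans (product-diff (x m) (y m) (x n) (y n)) (ℚ.≤-trans
        (ℚ.+-mono-≤
          (*-mono 0≤K₁ (ℚ.0≤∣p∣ (y m ℚ.- y n))
            (b₁ m (ℕ.m⊔n≤o⇒m≤o M₁ M₂ M≤m))
            (q m n (ℕ.m⊔n≤o⇒n≤o N₁ N₂ N≤m) (ℕ.m⊔n≤o⇒n≤o N₁ N₂ N≤n)))
          (*-mono 0≤K₂ (ℚ.0≤∣p∣ (x m ℚ.- x n))
            (b₂ n (ℕ.m⊔n≤o⇒n≤o M₁ M₂ M≤n))
            (p m n (ℕ.m⊔n≤o⇒m≤o N₁ N₂ N≤m) (ℕ.m⊔n≤o⇒m≤o N₁ N₂ N≤n))))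
        (common-factor K₁ K₂ (ℚ.<⇒≤ 0<δ) Kδ≡ε))

infixl 6 _+_
infixl 7 _*_

_+_ : ℝ → ℝ → ℝ
x + y = mkℝ (λ n → approx x n ℚ.+ approx y n)
            (+-cauchy {approx x} {approx y} (cauchy x) (cauchy y))

_*_ : ℝ → ℝ → ℝ
x * y = mkℝ (λ n → approx x n ℚ.* approx y n)
            (*-cauchy {approx x} {approx y} (cauchy x) (cauchy y))

------------------------------------------------------------------------
-- Lebesgue outer measure on ℝᵈ

record Box (d : ℕ) : Set where
  field
    lower upper : Vector ℚ d
    lower≤upper : ∀ i → lower i ℚ.≤ upper i

  volume : ℚ
  volume = Vector.foldr ℚ._*_ 1ℚ (λ i → upper i ℚ.- lower i)

infix 4 _∈ᵇ_

_∈ᵇ_ : ∀ {d} → Vector ℝ d → Box d → Set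
x ∈ᵇ B = ∀ i → fromℚ (lower i) ≤ x i × x i ≤ fromℚ (upper i)
  where open Box B

-- A countable family of boxes.  `nothing` stands for the empty box, so that
-- finite families are included also when d = 0, where every box has volume 1.
BoxFamily : ℕ → Set
BoxFamily d = ℕ → Maybe (Box d)

partialVolume : ∀ {d} → BoxFamily d → ℕ → ℚ
partialVolume B zero    = 0ℚ
partialVolume B (suc N) = partialVolume B N ℚ.+ maybe Box.volume 0ℚ (B N)

_Covers_ : ∀ {d} → BoxFamily d → (Vector ℝ d → Set) → Set
B Covers A = ∀ x → A x → ∃[ j ] Any (x ∈ᵇ_) (B j)

infix 4 _≤λ*_

-- ε is a lower bound for the total volume Σⱼ vol Bⱼ ∈ [0, ∞] of every
-- countable cover of A by boxes, i.e. for the infimum of these totals.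
_≤λ*_ : ∀ {d} → ℚ → (Vector ℝ d → Set) → Set
ε ≤λ* A = ∀ B → B Covers A → ∀ c → (∀ N → partialVolume B N ℚ.≤ c) → ε ℚ.≤ c

PositiveMeasure : ∀ {d} → (Vector ℝ d → Set) → Set
PositiveMeasure A = ∃[ ε ] (0ℚ ℚ.< ε × ε ≤λ* A)

------------------------------------------------------------------------
-- Markov chains

record Distribution (k : ℕ) : Set where
  field
    prob        : Fin k → ℝ
    nonNegative : ∀ i → 0ℝ ≤ prob i
    normalised  : Vector.foldr _+_ 0ℝ prob ≈ 1ℝ

open Distribution public using (prob)

record MarkovChain (k : ℕ) : Set where
  field
    initial    : Distribution k
    transition : Fin k → Distribution k

  π : Fin k → ℝ
  π = prob initial

  p : Fin k → Fin k → ℝ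
  p i = prob (transition i)

  simplexPoint : Fin (suc k) → Distribution k
  simplexPoint zero    = initial
  simplexPoint (suc i) = transition i

open MarkovChain public using (simplexPoint)

dim : ℕ → ℕ
dim k = suc k ℕ.* (k ℕ.∸ 1)

-- The nonzero states.  The affine coordinates on the simplex
-- { (x₀, …, xₖ₋₁) : xᵢ ≥ 0, Σ xᵢ = 1 } are x₁, …, xₖ₋₁.
free : ∀ {k} → Fin (k ℕ.∸ 1) → Fin k
free {suc k} = suc

coordinates : ∀ {k} → MarkovChain k → Vector ℝ (dim k)
coordinates {k} M i = uncurry (λ r c → prob (simplexPoint M r) (free c)) (remQuot {suc k} (k ℕ.∸ 1) i)

Image : ∀ {k} → (MarkovChain k → Set) → Vector ℝ (dim k) → Set
Image S x = ∃[ M ] (S M × (∀ i → coordinates M i ≈ x i))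

-- Up to a positive constant factor, Lebesgue measure on the product of
-- simplices is Lebesgue measure in the affine coordinates.  The sets it is
-- applied to are semialgebraic, so outer measure is measure.
HasPositiveMeasure : ∀ {k} → (MarkovChain k → Set) → Set
HasPositiveMeasure S = PositiveMeasure (Image S)

------------------------------------------------------------------------
-- Viterbi paths, regions and sequences

Sequence : ℕ → ℕ → Set
Sequence k n = Vec (Fin k) (suc n)

transitions : ∀ {k n} → Sequence k n → List (Fin k × Fin k)
transitions (s ∷ [])     = []
transitions (s ∷ t ∷ ts) = (s , t) ∷ transitions (t ∷ ts)

Pr : ∀ {k n} → MarkovChain k → Sequence k n → ℝ
Pr M s = π (head s) * foldr _*_ 1ℝ (map (uncurry p) (transitions s))
  where open MarkovChain M

IsViterbiPath : ∀ {k n} → MarkovChain k → Sequence k n → Set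
IsViterbiPath {k} {n} M s = ∀ (t : Sequence k n) → Pr M t ≤ Pr M s

SameRegion : ∀ {k} → ℕ → MarkovChain k → MarkovChain k → Set
SameRegion {k} n M M′ = ∀ (s : Sequence k n) → IsViterbiPath M s ⇔ IsViterbiPath M′ s

InViterbiRegion : ∀ {k} → ℕ → MarkovChain k → Set
InViterbiRegion n M = HasPositiveMeasure (SameRegion n M)

IsViterbiSequence : ∀ {k n} → Sequence k n → Set
IsViterbiSequence {k} {n} s = ∃[ M ] (InViterbiRegion {k} n M × IsViterbiPath M s)

infix 4 _∼_

_∼_ : ∀ {k n} → Sequence k n → Sequence k n → Set
s ∼ t = head s ≡ head t × transitions s ↭ transitions t

-- At most C equivalence classes (for ∼) of Viterbi sequences: pairwise
-- inequivalent Viterbi sequences number at most C.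
ViterbiSequences#≤ : ℕ → ℕ → ℕ → Set
ViterbiSequences#≤ k n C = ∀ (ss : List (Sequence k n)) →
  All IsViterbiSequence ss → AllPairs (λ s t → ¬ (s ∼ t)) ss → length ss ℕ.≤ C

{-# OPTIONS --safe #-}

-- Loop erasure writes the transitions of a sequence as a core walk of length at most k²
-- through all visited states plus simple cycles.  If two cycles a and b both occur at least
-- k times, then |b| copies of a can be traded for |a| copies of b and conversely; were the
-- sequence optimal, p(a)^|b| = p(b)^|a| would hold throughout its region.  If a has an edge
-- that b lacks, this equation determines one coordinate of the chain by the others, so the
-- region is null.  Hence all cycles occurring at least k times coincide as multisets of edges,
-- their multiplicity is fixed by the length n, and the class of a Viterbi sequence is determined
-- by its initial state, its core and the multiplicities of its cycles truncated at k.

module Submission where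

open import Defs hiding (_≤_; _+_; _*_; _≈_)
import Defs as ℝ
open import Data.Nat.Base using (ℕ) renaming (_≤_ to _≤ℕ_)
open import Data.Nat.Base as ℕ using (zero; suc; _≤_; _<_; _+_; _*_; _^_; _∸_; _⊓_; _⊔_; pred; z≤n; s≤s; z<s; s<s; NonZero; >-nonZero)
open import Data.Nat.ListAction using (product)
open import Data.Nat.ListAction.Properties using (product-++; product-↭)
open import Data.Nat.Properties as ℕ using (module ≤-Reasoning)
open import Data.Nat.Solver renaming (module +-*-Solver to ℕ-Solver)
open import Data.Integer.Base as ℤ using (-[1+_]) renaming (+_ to pos)
import Data.Integer.Properties as ℤ
open import Data.Rational.Base as ℚ using (ℚ; mkℚ; 0ℚ; 1ℚ; toℚᵘ)
import Data.Rational.Properties as ℚ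
open import Data.Rational.Solver renaming (module +-*-Solver to ℚ-Solver)
import Data.Rational.Unnormalised.Base as ℚᵘ
import Data.Rational.Unnormalised.Properties as ℚᵘ
open import Data.Fin.Base as Fin using (Fin; zero; suc; toℕ; fromℕ<; finToFun; funToFin; combine; remQuot)
import Data.Fin.Properties as Fin
open import Data.List.Base as List using (List; []; _∷_; _++_; [_]; length; map; concat; replicate; filter; lookup; allFin; cartesianProduct; cartesianProductWith; upTo)
import Data.List.Properties as List
open import Data.List.Membership.Propositional using (_∈_; _∉_; find)
open import Data.List.Membership.Propositional.Properties
open import Data.List.Membership.Propositional.Properties.WithK using (unique∧set⇒bag)
open import Data.List.Relation.Binary.BagAndSetEquality using (∼bag⇒↭)
open import Data.List.Relation.Binary.Permutation.Propositional using (_↭_; ↭-refl; ↭-sym; ↭-trans; ↭-reflexive; prep; module PermutationReasoning)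
import Data.List.Relation.Binary.Permutation.Propositional.Properties as ↭
open import Data.List.Relation.Unary.All as All using (All; []; _∷_)
import Data.List.Relation.Unary.All.Properties as All
open import Data.List.Relation.Unary.AllPairs using (AllPairs; []; _∷_)
open import Data.List.Relation.Unary.Any as Any using (here; there)
open import Data.List.Relation.Unary.Any.Properties using (lookup-index)
open import Data.List.Relation.Unary.Unique.Propositional using (Unique)
import Data.List.Relation.Unary.Unique.Propositional.Properties as Unique
open import Data.Maybe.Base using (Maybe; just; nothing; maybe)
open import Data.Maybe.Relation.Unary.Any as Maybe using (just)
open import Data.Product.Base using (Σ; _×_; _,_; proj₁; proj₂; ∃-syntax; ∃₂; map₁; uncurry)
open import Data.Product.Properties using (≡-dec)
open import Data.Sum.Base using (inj₁; inj₂)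
open import Data.Unit.Base using (⊤; tt)
open import Data.Vec.Base using (Vec; []; _∷_; head)
open import Data.Vec.Functional as Vector using (Vector; insertAt; removeAt)
open import Data.Vec.Functional.Properties using (insertAt-lookup; insertAt-punchIn)
open import Function.Base using (_∘_; id)
open import Function.Bundles using (mk⇔; Equivalence)
open import Relation.Binary.Definitions using (DecidableEquality)
open import Relation.Binary.PropositionalEquality using (_≡_; _≢_; _≗_; refl; sym; trans; cong; cong₂; subst; subst₂; module ≡-Reasoning)
open import Relation.Nullary using (¬_; yes; no; Dec; contradiction; ¬?)
open import Relation.Unary using (Decidable)

-- The obstacle is measure: a null set needs explicit covers, while the order on Cauchy reals is
-- undecidable. So chains are rounded to a grid of mesh `1/(N + 1)`, where probabilities become
-- products of natural numbers and optimality holds up to a relative error of order `1/N`. The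
-- equation between two cycles survives as a decidable near tie. Along one coordinate one side moves
-- strictly and the other never in the same direction, so near ties on a grid line lie within a
-- bounded number of steps, and about `N^(d - 1)` cubes of volume of order `N^(-d)` cover a region
-- of dimension `d`. The bound needs the other factors to stay away from 0. Optimality gives this:
-- following the largest entry of each row has probability at least `k^(-(n + 1))`, and no factor of
-- an optimal product is smaller. The core must meet every visited state because a cycle can be
-- reinserted only where it touches the walk. The threshold `k` bounds the length of a simple cycle,
-- so `|b|` copies of `a` and `|a|` copies of `b` are at hand.

private variable
  A B : Set
  k n : ℕ

-- Counting by codes

AllPairs-lookup : ∀ {R : A → A → Set} {xs} → AllPairs R xs →
  ∀ {i j} → i Fin.< j → R (lookup xs i) (lookup xs j)
AllPairs-lookup (px ∷ _)  {zero}  {suc j} _         = All.lookup px (∈-lookup j)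
AllPairs-lookup (_ ∷ pxs) {suc i} {suc j} (s<s i<j) = AllPairs-lookup pxs i<j

-- Pigeonhole on the indices of the codes in `codes`. Injectivity is asked only up to `R`, which
-- covers both distinct states and inequivalent sequences.
codes-bound : ∀ {P : A → Set} {R : A → A → Set} (code : A → B) (codes : List B) →
  (∀ x → P x → code x ∈ codes) → (∀ {x y} → P x → P y → code x ≡ code y → ¬ R x y) →
  ∀ {xs} → All P xs → AllPairs R xs → length xs ≤ length codes
codes-bound {A = A} {P = P} code codes code∈ collide {xs} Pxs Rxs = ℕ.≮⇒≥ λ codes< →
  let i , j , i<j , eq = Fin.pigeonhole codes< λ i → Any.index (code∈ (lookup xs i) (P-lookup i))
  in collide (P-lookup i) (P-lookup j)
       (trans (lookup-index (code∈ _ (P-lookup i)))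
         (trans (cong (lookup codes) eq) (sym (lookup-index (code∈ _ (P-lookup j))))))
       (AllPairs-lookup Rxs i<j)
  where
  P-lookup : ∀ i → P (lookup xs i)
  P-lookup i = All.lookup Pxs (∈-lookup i)

Unique⇒length≤ : {xs : List (Fin k)} → Unique xs → length xs ≤ k
Unique⇒length≤ {k} {xs} xs! = subst (length xs ≤_) (List.length-tabulate id)
  (codes-bound {P = λ _ → ⊤} id (allFin k) (λ x _ → ∈-allFin x) (λ _ _ eq neq → neq eq)
    (All.universal _ xs) xs!)

listsUpTo : List A → ℕ → List (List A)
listsUpTo xs zero    = [ [] ]
listsUpTo xs (suc m) = [] ∷ cartesianProductWith _∷_ xs (listsUpTo xs m)

∈-listsUpTo : ∀ {xs ys : List A} m → All (_∈ xs) ys → length ys ≤ m → ys ∈ listsUpTo xs m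
∈-listsUpTo {ys = []}     zero    _          _       = here refl
∈-listsUpTo {ys = []}     (suc m) _          _       = here refl
∈-listsUpTo {ys = y ∷ ys} (suc m) (y∈ ∷ ys∈) (s≤s h) =
  there (∈-cartesianProductWith⁺ _∷_ y∈ (∈-listsUpTo m ys∈ h))

map-≡⇒≗ : ∀ {f g : A → B} xs → map f xs ≡ map g xs → ∀ {x} → x ∈ xs → f x ≡ g x
map-≡⇒≗ (x ∷ xs) eq (here refl) = List.∷-injectiveˡ eq
map-≡⇒≗ (x ∷ xs) eq (there x∈)  = map-≡⇒≗ xs (List.∷-injectiveʳ eq) x∈

-- Multiplicities

concat-↭ : ∀ {xss yss : List (List A)} → xss ↭ yss → concat xss ↭ concat yss
concat-↭ _↭_.refl         = ↭-refl
concat-↭ (_↭_.prep xs p)  = ↭.++⁺ˡ xs (concat-↭ p)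
concat-↭ (_↭_.swap xs ys p) = ↭-trans (↭.shifts xs ys) (↭.++⁺ˡ ys (↭.++⁺ˡ xs (concat-↭ p)))
concat-↭ (_↭_.trans p q)  = ↭-trans (concat-↭ p) (concat-↭ q)

filter-¬filter-↭ : ∀ {P : A → Set} (P? : Decidable P) xs → xs ↭ filter P? xs ++ filter (¬? ∘ P?) xs
filter-¬filter-↭ P? [] = ↭-refl
filter-¬filter-↭ P? (x ∷ xs) with P? x
... | yes _ = prep x (filter-¬filter-↭ P? xs)
... | no  _ = ↭-trans (prep x (filter-¬filter-↭ P? xs)) (↭-sym (↭.shift x (filter P? xs) _))

∈⇒↭∷ : ∀ {x : A} {xs} → x ∈ xs → ∃[ ys ] xs ↭ x ∷ ys
∈⇒↭∷ x∈ with ys , zs , refl ← ∈-∃++ x∈ = ys ++ zs , ↭.shift _ ys zs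

module Multiplicity (_≟_ : DecidableEquality A) where

  mult : A → List A → ℕ
  mult x xs = length (filter (x ≟_) xs)

  mult-↭ : ∀ x {xs ys} → xs ↭ ys → mult x xs ≡ mult x ys
  mult-↭ x p = ↭.↭-length (↭.filter-↭ (x ≟_) p)

  mult-here : ∀ x xs → mult x (x ∷ xs) ≡ suc (mult x xs)
  mult-here x xs = cong length (List.filter-accept (x ≟_) refl)

  mult-skip : ∀ {x y} xs → x ≢ y → mult x (y ∷ xs) ≡ mult x xs
  mult-skip {x} xs x≢y = cong length (List.filter-reject (x ≟_) x≢y)

  ∈⇒mult>0 : ∀ {x xs} → x ∈ xs → 0 < mult x xs
  ∈⇒mult>0 {x} x∈ = List.filter-some (x ≟_) x∈

  mult>0⇒∈ : ∀ {x} xs → 0 < mult x xs → x ∈ xs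
  mult>0⇒∈ {x} (y ∷ xs) h with x ≟ y
  ... | yes x≡y = here x≡y
  ... | no  _   = there (mult>0⇒∈ xs h)

  extract : ∀ x xs m → m ≤ mult x xs → ∃[ ys ] xs ↭ replicate m x ++ ys
  extract x xs zero    _ = xs , ↭-refl
  extract x xs (suc m) h
    with ys , p ← ∈⇒↭∷ (mult>0⇒∈ xs (ℕ.≤-trans z<s h))
    with zs , q ← extract x ys m (ℕ.≤-pred (subst (suc m ≤_) (trans (mult-↭ x p) (mult-here x ys)) h))
    = zs , ↭-trans p (prep x q)

  mult-replicate-++ : ∀ {x y} m ys → x ≢ y → mult x (replicate m y ++ ys) ≡ mult x ys
  mult-replicate-++ zero    ys x≢y = refl
  mult-replicate-++ (suc m) ys x≢y = trans (mult-skip (replicate m _ ++ ys) x≢y) (mult-replicate-++ m ys x≢y)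

  -- Multiplicities are compared only where `P` holds, because the lists of cycles to be compared
  -- may differ in their frequent members.
  mult-≡⇒filter-↭ : ∀ {P : A → Set} (P? : Decidable P) xs ys →
    (∀ x → P x → mult x xs ≡ mult x ys) → filter P? xs ↭ filter P? ys
  mult-≡⇒filter-↭ P? [] ys eq = ↭-reflexive (sym (List.filter-none P? {xs = ys}
    (All.tabulate λ y∈ Py → ℕ.n≮0 (subst (0 <_) (sym (eq _ Py)) (∈⇒mult>0 y∈)))))
  mult-≡⇒filter-↭ P? (x ∷ xs) ys eq with P? x
  ... | no ¬Px = mult-≡⇒filter-↭ P? xs ys λ y Py →
    trans (sym (mult-skip xs λ { refl → ¬Px Py })) (eq y Py)
  ... | yes Px with zs , p ← ∈⇒↭∷ (mult>0⇒∈ ys (subst (0 <_) (eq x Px) (∈⇒mult>0 {xs = x ∷ xs} (here refl))))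
    = ↭-trans (prep x (mult-≡⇒filter-↭ P? xs zs λ y Py → mult-tail y (trans (eq y Py) (mult-↭ y p))))
        (↭-sym (↭-trans (↭.filter-↭ P? p) (↭-reflexive (List.filter-accept P? Px))))
    where
    mult-tail : ∀ y → mult y (x ∷ xs) ≡ mult y (x ∷ zs) → mult y xs ≡ mult y zs
    mult-tail y h with y ≟ x
    ... | yes _ = ℕ.suc-injective h
    ... | no  _ = h

-- Walks and simple cycles

Edge : ℕ → Set
Edge k = Fin k × Fin k

sources : List (Edge k) → List (Fin k)
sources = map proj₁

data Walk {k} : Fin k → List (Edge k) → Fin k → Set where
  []   : ∀ {x} → Walk x [] x
  step : ∀ {x y z es} → Walk y es z → Walk x ((x , y) ∷ es) z

-- The visited vertices. The last one is the source of no further edge, and even the empty walk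
-- visits a vertex.
stations : List (Edge k) → Fin k → List (Fin k)
stations es z = sources es ++ [ z ]

-- The list fixes a starting point, so rotations of one closed walk are different cycles here; they
-- agree only up to permutation of edges.
record IsSimpleCycle (c : List (Edge k)) : Set where
  constructor simpleCycle
  field
    {base}         : Fin k
    walk           : Walk base c base
    unique-sources : Unique (sources c)
    nonempty       : 0 < length c

  length≤ : length c ≤ k
  length≤ = subst (_≤ k) (List.length-map proj₁ c) (Unique⇒length≤ unique-sources)

private variable
  x y z : Fin k
  es fs c : List (Edge k)

_⊕_ : Walk x es y → Walk y fs z → Walk x (es ++ fs) z
[]     ⊕ v = v
step u ⊕ v = step (u ⊕ v)

splitAt : Walk x es z → y ∈ stations es z →
  ∃₂ λ es₁ es₂ → es ≡ es₁ ++ es₂ × Walk x es₁ y × Walk y es₂ z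
splitAt []       (here refl) = [] , [] , refl , [] , []
splitAt (step u) (here refl) = [] , _ , refl , [] , step u
splitAt (step u) (there y∈) with es₁ , es₂ , refl , u₁ , u₂ ← splitAt u y∈
  = _ ∷ es₁ , es₂ , refl , step u₁ , u₂

start∈stations : Walk x es z → x ∈ stations es z
start∈stations []       = here refl
start∈stations (step _) = here refl

stations-++ : ∀ (es fs : List (Edge k)) → stations (es ++ fs) z ≡ sources es ++ stations fs z
stations-++ es fs = trans (cong (_++ _) (List.map-++ proj₁ es fs)) (List.++-assoc (sources es) (sources fs) _)

stations-⊆ : ∀ {es fs gs : List (Edge k)} → es ↭ fs ++ gs → y ∈ stations fs z → y ∈ stations es z
stations-⊆ {fs = fs} {gs} p y∈ with ∈-++⁻ (sources fs) y∈
... | inj₂ y∈z = ∈-++⁺ʳ _ y∈z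
... | inj₁ y∈f = ∈-++⁺ˡ (↭.∈-resp-↭ (↭-sym (↭.map⁺ proj₁ p))
  (subst (_ ∈_) (sym (List.map-++ proj₁ fs gs)) (∈-++⁺ˡ y∈f)))

sources-⊆ : ∀ {es fs gs : List (Edge k)} → es ↭ fs ++ gs → y ∈ sources gs → y ∈ stations es z
sources-⊆ {fs = fs} {gs} p y∈ = ∈-++⁺ˡ (↭.∈-resp-↭ (↭-sym (↭.map⁺ proj₁ p))
  (subst (_ ∈_) (sym (List.map-++ proj₁ fs gs)) (∈-++⁺ʳ (sources fs) y∈)))

++-⊆ : ∀ {A : Set} (xs : List A) {ys zs} → (∀ {v} → v ∈ xs → v ∈ zs) → (∀ {v} → v ∈ ys → v ∈ zs) →
  ∀ {v} → v ∈ xs ++ ys → v ∈ zs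
++-⊆ xs xs⊆ ys⊆ v∈ with ∈-++⁻ xs v∈
... | inj₁ v∈xs = xs⊆ v∈xs
... | inj₂ v∈ys = ys⊆ v∈ys

Touches : List (Edge k) → List (Fin k) → Set
Touches c V = ∃[ u ] (u ∈ V × u ∈ sources c)

-- Cut walk and cycle at a common vertex; the rotation `c₂ ++ c₁` of the cycle starts and ends there
-- and can be spliced in.
insertCycle : Walk x es z → IsSimpleCycle c → Touches c (stations es z) →
  ∃[ fs ] (Walk x fs z × fs ↭ es ++ c)
insertCycle {c = c} w C (u , u∈w , u∈c)
  with es₁ , es₂ , refl , w₁ , w₂ ← splitAt w u∈w
  with c₁ , c₂ , refl , v₁ , v₂ ← splitAt (IsSimpleCycle.walk C) (∈-++⁺ˡ u∈c)
  = es₁ ++ (c₂ ++ c₁) ++ es₂ , w₁ ⊕ ((v₂ ⊕ v₁) ⊕ w₂) , (begin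
      es₁ ++ (c₂ ++ c₁) ++ es₂  ↭⟨ ↭.++⁺ˡ es₁ (↭.++-comm (c₂ ++ c₁) es₂) ⟩
      es₁ ++ es₂ ++ (c₂ ++ c₁)  ↭⟨ ↭.++⁺ˡ es₁ (↭.++⁺ˡ es₂ (↭.++-comm c₂ c₁)) ⟩
      es₁ ++ es₂ ++ (c₁ ++ c₂)  ≡⟨ List.++-assoc es₁ es₂ _ ⟨
      (es₁ ++ es₂) ++ c₁ ++ c₂  ∎)
  where open PermutationReasoning

insertCycles : Walk x es z → ∀ {cs} → All IsSimpleCycle cs → All (λ c → Touches c (stations es z)) cs →
  ∃[ fs ] (Walk x fs z × fs ↭ es ++ concat cs)
insertCycles {es = es} w [] [] = es , w , ↭-reflexive (sym (List.++-identityʳ es))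
insertCycles {es = es} w {c ∷ cs} (C ∷ Cs) (t ∷ ts)
  with fs , v , p ← insertCycle w C t
  with gs , u , q ← insertCycles v Cs (All.map (λ (a , a∈ , a∈c) → a , stations-⊆ p a∈ , a∈c) ts)
  = gs , u , ↭-trans q (↭-trans (↭.++⁺ʳ (concat cs) p) (↭-reflexive (List.++-assoc es c (concat cs))))

-- A cycle may hang on an earlier cycle of the list instead of on `V`: when a loop is cut out of a
-- path, cycles that hung on the loop can lose contact with the path.
Attached : List (Fin k) → List (List (Edge k)) → Set
Attached V []       = ⊤
Attached V (c ∷ cs) = Touches c V × Attached (V ++ sources c) cs

Attached-mono : ∀ {V W : List (Fin k)} cs → (∀ {v} → v ∈ V → v ∈ W) → Attached V cs → Attached W cs
Attached-mono [] _ _ = tt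
Attached-mono {V = V} {W} (c ∷ cs) V⊆W ((u , u∈V , u∈c) , rest) =
  (u , V⊆W u∈V , u∈c) , Attached-mono cs (++-⊆ V (∈-++⁺ˡ ∘ V⊆W) (∈-++⁺ʳ W)) rest

record LoopErasure (x : Fin k) (es : List (Edge k)) (z : Fin k) : Set where
  field
    path     : List (Edge k)
    walk     : Walk x path z
    simple   : Unique (stations path z)
    cycles   : List (List (Edge k))
    areCycles : All IsSimpleCycle cycles
    attached : Attached (stations path z) cycles
    edges-↭  : es ↭ path ++ concat cycles

Unique-++⁻ : ∀ (xs : List A) {ys} → Unique (xs ++ ys) →
  Unique xs × Unique ys × (∀ {y} → y ∈ ys → y ∉ xs)
Unique-++⁻ []       ys! = [] , ys! , λ _ ()
Unique-++⁻ (x ∷ xs) (x∉ ∷ xs!) with xs!′ , ys! , disj ← Unique-++⁻ xs xs!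
  = All.++⁻ˡ xs x∉ ∷ xs!′ , ys! , λ where
      y∈ys (here refl)  → All.lookup (All.++⁻ʳ xs x∉) y∈ys refl
      y∈ys (there y∈xs) → disj y∈ys y∈xs

-- The walk is built up from its end. A new edge whose source already lies on the simple path closes
-- a loop with the initial part `P₁`. This loop goes to the front of the list, so that its vertices
-- replace those of `P₁` for the cycles already attached.
loopErase : Walk x es z → LoopErasure x es z
loopErase [] = record
  { path = [] ; walk = [] ; simple = [] ∷ [] ; cycles = [] ; areCycles = [] ; attached = tt ; edges-↭ = ↭-refl }
loopErase {x = x} {z = z} (step {y = y} u) with loopErase u
... | record { path = P ; walk = w ; simple = P! ; cycles = cs ; areCycles = Cs ; attached = att ; edges-↭ = p }
  with Any.any? (x Fin.≟_) (stations P z)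
... | no x∉ = record
  { path = (x , y) ∷ P ; walk = step w ; simple = All.¬Any⇒All¬ _ x∉ ∷ P! ; cycles = cs ; areCycles = Cs
  ; attached = Attached-mono cs there att ; edges-↭ = prep _ p }
... | yes x∈ with P₁ , P₂ , refl , w₁ , w₂ ← splitAt w x∈
  with P₁! , P₂! , disj ← Unique-++⁻ (sources P₁) (subst Unique (stations-++ P₁ P₂) P!)
  = record
  { path = P₂ ; walk = w₂ ; simple = P₂! ; cycles = ((x , y) ∷ P₁) ∷ cs
  ; areCycles = simpleCycle (step w₁) (All.tabulate (λ { v∈ refl → disj (start∈stations w₂) v∈ }) ∷ P₁!) z<s ∷ Cs
  ; attached = (x , start∈stations w₂ , here refl) , Attached-mono cs ⊆′ att
  ; edges-↭ = begin
      (x , y) ∷ _                                  ↭⟨ prep _ p ⟩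
      (x , y) ∷ (P₁ ++ P₂) ++ concat cs            ≡⟨ cong ((x , y) ∷_) (List.++-assoc P₁ P₂ _) ⟩
      ((x , y) ∷ P₁) ++ P₂ ++ concat cs            ↭⟨ ↭.shifts ((x , y) ∷ P₁) P₂ ⟩
      P₂ ++ ((x , y) ∷ P₁) ++ concat cs            ∎ }
  where
  open PermutationReasoning
  ⊆′ : ∀ {v} → v ∈ stations (P₁ ++ P₂) z → v ∈ stations P₂ z ++ x ∷ sources P₁
  ⊆′ = ++-⊆ (sources P₁) (∈-++⁺ʳ (stations P₂ z) ∘ there) ∈-++⁺ˡ ∘ subst (_ ∈_) (stations-++ P₁ P₂)

record Decomposition (x : Fin k) (es : List (Edge k)) (z : Fin k) : Set where
  field
    core      : List (Edge k)
    walk      : Walk x core z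
    core≤     : length core ≤ k * k
    cycles    : List (List (Edge k))
    areCycles : All IsSimpleCycle cycles
    touch     : All (λ c → Touches c (stations core z)) cycles
    edges-↭   : es ↭ core ++ concat cycles

-- A cycle visiting new states is merged into the core; the list U of
-- distinct visited states grows each time, which bounds the core.
absorb : ∀ {core : List (Edge k)} {V U} cs → Walk x core z → All IsSimpleCycle cs → Attached V cs →
  (∀ {v} → v ∈ V → v ∈ stations core z) →
  Unique U → (∀ {v} → v ∈ U → v ∈ stations core z) → length core ≤ k * length U →
  Σ (Decomposition x (core ++ concat cs) z) λ D →
    ∀ {v} → v ∈ stations core z → v ∈ stations (Decomposition.core D) z
absorb {k} {core = core} [] w [] _ V⊆ U! U⊆ core≤ = record
  { core = core ; walk = w ; core≤ = ℕ.≤-trans core≤ (ℕ.*-monoʳ-≤ k (Unique⇒length≤ U!))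
  ; cycles = [] ; areCycles = [] ; touch = [] ; edges-↭ = ↭-refl } , id
absorb {k} {z = z} {core} {V} {U} (c ∷ cs) w (C ∷ Cs) ((u , u∈V , u∈c) , att) V⊆ U! U⊆ core≤
  with All.all? (λ v → Any.any? (v Fin.≟_) (stations core z)) (sources c)
... | yes c⊆ = record
  { core = D.core ; walk = D.walk ; core≤ = D.core≤ ; cycles = c ∷ D.cycles ; areCycles = C ∷ D.areCycles
  ; touch = (u , ⊆D (V⊆ u∈V) , u∈c) ∷ D.touch
  ; edges-↭ = begin
      core ++ c ++ concat cs              ↭⟨ ↭.shifts core c ⟩
      c ++ core ++ concat cs              ↭⟨ ↭.++⁺ˡ c D.edges-↭ ⟩
      c ++ D.core ++ concat D.cycles      ↭⟨ ↭.shifts c D.core ⟩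
      D.core ++ c ++ concat D.cycles      ∎ } , ⊆D
  where
  open PermutationReasoning
  rec = absorb cs w Cs att (++-⊆ V V⊆ (All.lookup c⊆)) U! U⊆ core≤
  module D = Decomposition (proj₁ rec)
  ⊆D = proj₂ rec
... | no c⊈ = record
  { core = D.core ; walk = D.walk ; core≤ = D.core≤ ; cycles = D.cycles ; areCycles = D.areCycles
  ; touch = D.touch
  ; edges-↭ = ↭-trans (↭-reflexive (sym (List.++-assoc core c _)))
      (↭-trans (↭.++⁺ʳ (concat cs) (↭-sym p)) D.edges-↭) } , proj₂ rec ∘ stations-⊆ p
  where
  open ≤-Reasoning
  new = find (All.¬All⇒Any¬ (λ v → Any.any? (v Fin.≟_) (stations core z)) (sources c) c⊈)
  v = proj₁ new
  v∈c = proj₁ (proj₂ new)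
  v∉ = proj₂ (proj₂ new)
  merged = insertCycle w C (u , V⊆ u∈V , u∈c)
  core′ = proj₁ merged
  p : core′ ↭ core ++ c
  p = proj₂ (proj₂ merged)
  core′≤ : length core′ ≤ k * suc (length U)
  core′≤ = begin
    length core′               ≡⟨ ↭.↭-length p ⟩
    length (core ++ c)         ≡⟨ List.length-++ core ⟩
    length core + length c     ≤⟨ ℕ.+-mono-≤ core≤ (IsSimpleCycle.length≤ C) ⟩
    k * length U + k           ≡⟨ ℕ.+-comm (k * length U) k ⟩
    k + k * length U           ≡⟨ ℕ.*-suc k (length U) ⟨
    k * suc (length U)         ∎
  U′⊆ : ∀ {t} → t ∈ v ∷ U → t ∈ stations core′ z
  U′⊆ (here refl) = sources-⊆ p v∈c
  U′⊆ (there t∈U) = stations-⊆ p (U⊆ t∈U)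
  rec = absorb cs (proj₁ (proj₂ merged)) Cs att (++-⊆ V (stations-⊆ p ∘ V⊆) (sources-⊆ p))
    (All.tabulate (λ { t∈U refl → v∉ (U⊆ t∈U) }) ∷ U!) U′⊆ core′≤
  module D = Decomposition (proj₁ rec)

decompose : Walk x es z → Decomposition {k} x es z
decompose {k} {x} {es} {z} w = record
  { core = D.core ; walk = D.walk ; core≤ = D.core≤ ; cycles = D.cycles ; areCycles = D.areCycles
  ; touch = D.touch ; edges-↭ = ↭-trans E.edges-↭ D.edges-↭ }
  where
  open ≤-Reasoning
  module E = LoopErasure (loopErase w)
  -- The state is matched on only to see that `k` is positive.
  path≤ : Fin k → length E.path ≤ k * length (stations E.path z)
  path≤ zero    = begin
    length E.path                      ≡⟨ List.length-map proj₁ E.path ⟨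
    length (sources E.path)            ≤⟨ ℕ.m≤m+n _ 1 ⟩
    length (sources E.path) + 1        ≡⟨ List.length-++ (sources E.path) ⟨
    length (stations E.path z)         ≤⟨ ℕ.m≤n*m _ k ⟩
    k * length (stations E.path z)     ∎
  path≤ (suc i) = path≤ zero
  module D = Decomposition (proj₁ (absorb E.cycles E.walk E.areCycles E.attached id E.simple id (path≤ x)))

-- Parameter cells and the exchange of cycles

Cell : ℕ → Set
Cell k = Fin (suc k) × Fin k

transitionCells : List (Edge k) → List (Cell k)
transitionCells = map (map₁ suc)

-- Row 0 of the parameter matrix is the initial distribution.
cells : Sequence k n → List (Cell k)
cells s = (zero , head s) ∷ transitionCells (transitions s)

rep : ℕ → List A → List A
rep m xs = concat (replicate m xs)

length-rep : ∀ m (xs : List A) → length (rep m xs) ≡ m * length xs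
length-rep zero    xs = refl
length-rep (suc m) xs = trans (List.length-++ xs) (cong (length xs +_) (length-rep m xs))

∈-rep⁻ : ∀ m {xs : List A} {v} → v ∈ rep m xs → v ∈ xs
∈-rep⁻ (suc m) {xs} = ++-⊆ xs id (∈-rep⁻ m)

∈-rep⁺ : ∀ {m} {xs : List A} {v} → 0 < m → v ∈ xs → v ∈ rep m xs
∈-rep⁺ {m = suc m} _ = ∈-++⁺ˡ

concat-↭-rep : ∀ {c : List A} {cs} → All (_↭ c) cs → concat cs ↭ rep (length cs) c
concat-↭-rep []       = ↭-refl
concat-↭-rep (p ∷ ps) = ↭.++⁺ p (concat-↭-rep ps)

Unique-map-injective : ∀ {f : A → B} {xs} → Unique (map f xs) → ∀ {v w} → v ∈ xs → w ∈ xs → f v ≡ f w → v ≡ w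
Unique-map-injective (_ ∷ _)  (here refl) (here refl) _  = refl
Unique-map-injective {f = f} (p ∷ _)  (here refl) (there w∈) eq = contradiction eq (All.lookup p (∈-map⁺ f w∈))
Unique-map-injective {f = f} (p ∷ _)  (there v∈)  (here refl) eq = contradiction (sym eq) (All.lookup p (∈-map⁺ f v∈))
Unique-map-injective (_ ∷ ps) (there v∈)  (there w∈)  eq = Unique-map-injective ps v∈ w∈ eq

_≟ᵉ_ : DecidableEquality (Edge k)
_≟ᵉ_ = ≡-dec Fin._≟_ Fin._≟_

module _ {k : ℕ} where
  open Multiplicity (List.≡-dec (_≟ᵉ_ {k})) public

sequenceWalk : ∀ (s : Sequence k n) → ∃[ z ] Walk (head s) (transitions s) z
sequenceWalk (x ∷ [])     = x , []
sequenceWalk (x ∷ y ∷ ys) with z , w ← sequenceWalk (y ∷ ys) = z , step w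

length-transitions : ∀ (s : Sequence k n) → length (transitions s) ≡ n
length-transitions (x ∷ [])     = refl
length-transitions (x ∷ y ∷ ys) = cong suc (length-transitions (y ∷ ys))

length-cells : ∀ (s : Sequence k n) → length (cells s) ≡ suc n
length-cells s = cong suc (trans (List.length-map _ (transitions s)) (length-transitions s))

walkSequence : Walk x es z → length es ≡ n → Σ (Sequence k n) λ s → head s ≡ x × transitions s ≡ es
walkSequence {x = x} []       refl = x ∷ [] , refl , refl
walkSequence {x = x} (step w) refl with s@(_ ∷ _) , refl , eq ← walkSequence w refl
  = x ∷ s , refl , cong (_ ∷_) eq

cells-↭ : ∀ {s : Sequence k n} {es fs gs} → head s ≡ x → transitions s ↭ es ++ fs ++ gs →
  cells s ↭ ((zero , x) ∷ transitionCells es) ++ transitionCells fs ++ transitionCells gs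
cells-↭ {s = s} {es} {fs} {gs} refl p = prep _ (begin
  transitionCells (transitions s)                                    ↭⟨ ↭.map⁺ (map₁ suc) p ⟩
  transitionCells (es ++ fs ++ gs)                                   ≡⟨ List.map-++ _ es (fs ++ gs) ⟩
  transitionCells es ++ transitionCells (fs ++ gs)                   ≡⟨ cong (transitionCells es ++_) (List.map-++ _ fs gs) ⟩
  transitionCells es ++ transitionCells fs ++ transitionCells gs     ∎)
  where open PermutationReasoning

concat-++-↭ : ∀ (core : List A) zs as bs →
  core ++ concat (zs ++ as ++ bs) ↭ (core ++ concat zs) ++ concat as ++ concat bs
concat-++-↭ core zs as bs = ↭-reflexive (begin
  core ++ concat (zs ++ as ++ bs)                     ≡⟨ cong (core ++_) (List.concat-++ zs (as ++ bs)) ⟨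
  core ++ concat zs ++ concat (as ++ bs)              ≡⟨ cong (λ ts → core ++ concat zs ++ ts) (List.concat-++ as bs) ⟨
  core ++ concat zs ++ concat as ++ concat bs         ≡⟨ List.++-assoc core (concat zs) _ ⟨
  (core ++ concat zs) ++ concat as ++ concat bs       ∎)
  where open ≡-Reasoning

-- Trading |b| copies of a for |a| copies of b, or conversely, keeps the length.
record Exchange {k n} (s : Sequence k n) (a b : List (Edge k)) : Set where
  field
    s₊ s₋    : Sequence k n
    rest     : List (Cell k)
    cells-s  : cells s  ↭ rest ++ transitionCells (rep (length b) a) ++ transitionCells (rep (length a) b)
    cells-s₊ : cells s₊ ↭ rest ++ transitionCells (rep (length b) a) ++ transitionCells (rep (length b) a)
    cells-s₋ : cells s₋ ↭ rest ++ transitionCells (rep (length a) b) ++ transitionCells (rep (length a) b)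

replicate-⊆ : ∀ m {x : A} {xs} → x ∈ xs → ∀ {v} → v ∈ replicate m x → v ∈ xs
replicate-⊆ (suc m) x∈ (here refl) = x∈
replicate-⊆ (suc m) x∈ (there v∈)  = replicate-⊆ m x∈ v∈

module _ {s : Sequence k n} (D : Decomposition (head s) (transitions s) z) where
  open Decomposition D

  -- The cycles of `cs` may occur with any multiplicities, since each touches the core; only the
  -- total length has to be that of `s`.
  realise : ∀ {cs} → (∀ {c} → c ∈ cs → c ∈ cycles) → length (core ++ concat cs) ≡ n →
    Σ (Sequence k n) λ t → head t ≡ head s × transitions t ↭ core ++ concat cs
  realise cs⊆ len
    with fs , w , p ← insertCycles walk (All.tabulate (All.lookup areCycles ∘ cs⊆)) (All.tabulate (All.lookup touch ∘ cs⊆))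
    with t , head≡ , refl ← walkSequence w (trans (↭.↭-length p) len) = t , head≡ , p

  -- Cycle lengths are at most `k`, so enough copies of both cycles are present, and both blocks
  -- have `|a| |b|` edges.
  frequent-exchange : ∀ {a b} → a ∈ cycles → b ∈ cycles → k ≤ mult a cycles → k ≤ mult b cycles → a ≢ b →
    Exchange s a b
  frequent-exchange {a} {b} a∈ b∈ ka kb a≢b = record
    { s₊ = proj₁ seq₊ ; s₋ = proj₁ seq₋ ; rest = (zero , head s) ∷ transitionCells (core ++ concat zs)
    ; cells-s  = cells-↭ {s = s} {es = core ++ concat zs} {fs = concat as} {concat bs} refl tr-s
    ; cells-s₊ = cells-↭ {s = proj₁ seq₊} {es = core ++ concat zs} {fs = concat as} {concat as} (proj₁ (proj₂ seq₊))
        (↭-trans (proj₂ (proj₂ seq₊)) (concat-++-↭ core zs as as))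
    ; cells-s₋ = cells-↭ {s = proj₁ seq₋} {es = core ++ concat zs} {fs = concat bs} {concat bs} (proj₁ (proj₂ seq₋))
        (↭-trans (proj₂ (proj₂ seq₋)) (concat-++-↭ core zs bs bs)) }
    where
    as = replicate (length b) a
    bs = replicate (length a) b
    len≤ : ∀ {c} → c ∈ cycles → length c ≤ k
    len≤ c∈ = IsSimpleCycle.length≤ (All.lookup areCycles c∈)
    ex-a = extract a cycles (length b) (ℕ.≤-trans (len≤ b∈) ka)
    ys = proj₁ ex-a
    -- Removing copies of `a` leaves the multiplicity of `b` unchanged because `a ≢ b`.
    ex-b = extract b ys (length a) (ℕ.≤-trans (len≤ a∈) (ℕ.≤-trans kb (ℕ.≤-reflexive
      (trans (mult-↭ b (proj₂ ex-a)) (mult-replicate-++ (length b) ys (a≢b ∘ sym))))))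
    zs = proj₁ ex-b
    cycles-↭ : cycles ↭ zs ++ as ++ bs
    cycles-↭ = ↭-trans (proj₂ ex-a) (↭-trans (↭.++⁺ˡ as (proj₂ ex-b))
      (↭-trans (↭-reflexive (sym (List.++-assoc as bs zs))) (↭.++-comm (as ++ bs) zs)))
    tr-s : transitions s ↭ (core ++ concat zs) ++ concat as ++ concat bs
    tr-s = ↭-trans edges-↭ (↭-trans (↭.++⁺ˡ core (concat-↭ cycles-↭)) (concat-++-↭ core zs as bs))
    zs⊆ : ∀ {v} → v ∈ zs → v ∈ cycles
    zs⊆ v∈ = ↭.∈-resp-↭ (↭-sym cycles-↭) (∈-++⁺ˡ v∈)
    as⊆ : ∀ {v} → v ∈ as → v ∈ cycles
    as⊆ = replicate-⊆ (length b) a∈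
    bs⊆ : ∀ {v} → v ∈ bs → v ∈ cycles
    bs⊆ = replicate-⊆ (length a) b∈
    length-as≡bs : length (concat as) ≡ length (concat bs)
    length-as≡bs = trans (length-rep (length b) a) (trans (ℕ.*-comm (length b) (length a)) (sym (length-rep (length a) b)))
    length≡ : ∀ us vs → length (concat us) ≡ length (concat as) → length (concat vs) ≡ length (concat bs) →
      length (core ++ concat (zs ++ us ++ vs)) ≡ n
    length≡ us vs equ eqv = begin
      length (core ++ concat (zs ++ us ++ vs))                            ≡⟨ ↭.↭-length (concat-++-↭ core zs us vs) ⟩
      length (R ++ concat us ++ concat vs)                                ≡⟨ length-++₃ R (concat us) ⟩
      length R + (length (concat us) + length (concat vs))                ≡⟨ cong (length R +_) (cong₂ _+_ equ eqv) ⟩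
      length R + (length (concat as) + length (concat bs))                ≡⟨ length-++₃ R (concat as) ⟨
      length (R ++ concat as ++ concat bs)                                ≡⟨ ↭.↭-length tr-s ⟨
      length (transitions s)                                              ≡⟨ length-transitions s ⟩
      n                                                                   ∎
      where
      open ≡-Reasoning
      R = core ++ concat zs
      length-++₃ : ∀ (xs : List (Edge k)) ys {zs} → length (xs ++ ys ++ zs) ≡ length xs + (length ys + length zs)
      length-++₃ xs ys = trans (List.length-++ xs) (cong (length xs +_) (List.length-++ ys))
    seq₊ = realise (++-⊆ zs zs⊆ (++-⊆ as as⊆ as⊆)) (length≡ as as refl length-as≡bs)
    seq₋ = realise (++-⊆ zs zs⊆ (++-⊆ bs bs⊆ bs⊆)) (length≡ bs bs (sym length-as≡bs) refl)

-- Near ties on an integer grid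

-- For grid numerators `W` of the parameters, this is the probability times the grid denominator
-- raised to the number of cells.
weight : (A → ℕ) → List A → ℕ
weight W cs = product (map W cs)

weight-++ : ∀ (W : A → ℕ) cs ds → weight W (cs ++ ds) ≡ weight W cs * weight W ds
weight-++ W cs ds = trans (cong product (List.map-++ W cs ds)) (product-++ (map W cs) (map W ds))

weight-↭ : ∀ (W : A → ℕ) {cs ds} → cs ↭ ds → weight W cs ≡ weight W ds
weight-↭ W p = product-↭ (↭.map⁺ W p)

weight-≤-^ : ∀ {W : A → ℕ} {N} → (∀ c → W c ≤ N) → ∀ cs → weight W cs ≤ N ^ length cs
weight-≤-^ W≤ []       = ℕ.≤-refl
weight-≤-^ W≤ (c ∷ cs) = ℕ.*-mono-≤ (W≤ c) (weight-≤-^ W≤ cs)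

weight-mono : ∀ {W V : A → ℕ} {cs} → All (λ c → W c ≤ V c) cs → weight W cs ≤ weight V cs
weight-mono []       = ℕ.≤-refl
weight-mono (p ∷ ps) = ℕ.*-mono-≤ p (weight-mono ps)

interchange : ∀ a b c d → (a * b) * (c * d) ≡ (a * c) * (b * d)
interchange = solve 4 (λ a b c d → (a :* b) :* (c :* d) := (a :* c) :* (b :* d)) refl
  where open ℕ-Solver

^-≤-weight : ∀ {W : A → ℕ} {N D cs} → All (λ c → N ≤ D * W c) cs →
  N ^ length cs ≤ D ^ length cs * weight W cs
^-≤-weight []       = ℕ.≤-refl
^-≤-weight {W = W} {N} {D} {c ∷ cs} (p ∷ ps) = begin
  N * N ^ length cs                              ≤⟨ ℕ.*-mono-≤ p (^-≤-weight ps) ⟩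
  (D * W c) * (D ^ length cs * weight W cs)      ≡⟨ interchange D (W c) _ _ ⟩
  (D * D ^ length cs) * (W c * weight W cs)      ∎
  where open ≤-Reasoning

-- The other `m` factors contribute at most `N ^ m`, so a product within a factor `D` of `N ^ suc m`
-- leaves no room for a factor below `N / D`.
factor-large : ∀ {W : A → ℕ} {N D m} .{{_ : NonZero N}} → (∀ c → W c ≤ N) → ∀ {cs} → length cs ≡ suc m →
  N ^ suc m ≤ D * weight W cs → ∀ {c} → c ∈ cs → N ≤ D * W c
factor-large {W = W} {N} {D} {m} W≤ {cs} len large {c} c∈ with ds , p ← ∈⇒↭∷ c∈ =
  ℕ.*-cancelʳ-≤ N (D * W c) (N ^ m) {{ℕ.m^n≢0 N m}} (begin
    N * N ^ m                     ≤⟨ large ⟩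
    D * weight W cs               ≡⟨ cong (D *_) (weight-↭ W p) ⟩
    D * (W c * weight W ds)       ≤⟨ ℕ.*-monoʳ-≤ D (ℕ.*-monoʳ-≤ (W c) (weight-≤-^ W≤ ds)) ⟩
    D * (W c * N ^ length ds)     ≡⟨ cong (λ l → D * (W c * N ^ l)) (ℕ.suc-injective (trans (sym (↭.↭-length p)) len)) ⟩
    D * (W c * N ^ m)             ≡⟨ ℕ.*-assoc D (W c) _ ⟨
    D * W c * N ^ m               ∎)
  where open ≤-Reasoning

-- From ραα ≤ ραβ + L N^m one gets ρα(α − β) ≤ L N^m, and ρα is large because ραβ is.
balance : ∀ {N D L l m ρ α β} .{{_ : NonZero N}} → N ^ suc m ≤ D * (ρ * (α * β)) → β ≤ N ^ l →
  ρ * (α * α) ≤ ρ * (α * β) + L * N ^ m → N * α ≤ N * β + D * L * N ^ l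
balance {N} {D} {L} {l} {m} {ρ} {α} {β} large β≤ better with ℕ.≤-total α β
... | inj₁ α≤β = ℕ.≤-trans (ℕ.*-monoʳ-≤ N α≤β) (ℕ.m≤m+n _ _)
... | inj₂ β≤α with γ , refl ← ℕ.m≤n⇒∃[o]m+o≡n β≤α = begin
    N * (β + γ)               ≡⟨ ℕ.*-distribˡ-+ N β γ ⟩
    N * β + N * γ             ≤⟨ ℕ.+-monoʳ-≤ (N * β) Nγ≤ ⟩
    N * β + D * L * N ^ l     ∎
  where
  open ≤-Reasoning
  gap : ρ * (α * γ) ≤ L * N ^ m
  gap = ℕ.+-cancelˡ-≤ (ρ * (α * β)) _ _ (begin
    ρ * (α * β) + ρ * (α * γ)   ≡⟨ solve 4 (λ r a b c → r :* (a :* b) :+ r :* (a :* c) := r :* (a :* (b :+ c))) refl ρ α β γ ⟩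
    ρ * (α * (β + γ))           ≤⟨ better ⟩
    ρ * (α * β) + L * N ^ m     ∎)
    where open ℕ-Solver
  Nγ≤ : N * γ ≤ D * L * N ^ l
  Nγ≤ = ℕ.*-cancelˡ-≤ (N ^ m) {{ℕ.m^n≢0 N m}} (begin
    N ^ m * (N * γ)                   ≡⟨ solve 3 (λ p n c → p :* (n :* c) := (n :* p) :* c) refl (N ^ m) N γ ⟩
    N ^ suc m * γ                     ≤⟨ ℕ.*-monoˡ-≤ γ large ⟩
    D * (ρ * (α * β)) * γ             ≡⟨ solve 5 (λ d r a b c → d :* (r :* (a :* b)) :* c := d :* (r :* (a :* c)) :* b) refl D ρ α β γ ⟩
    D * (ρ * (α * γ)) * β             ≤⟨ ℕ.*-mono-≤ (ℕ.*-monoʳ-≤ D gap) β≤ ⟩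
    D * (L * N ^ m) * N ^ l           ≡⟨ solve 4 (λ d l p q → d :* (l :* p) :* q := p :* (d :* l :* q)) refl D L (N ^ m) (N ^ l) ⟩
    N ^ m * (D * L * N ^ l)           ∎)
    where open ℕ-Solver

record NearTie (N D L : ℕ) (X Y : List A) (W : A → ℕ) : Set where
  constructor nearTie
  field
    large : All (λ c → N ≤ D * W c) X
    X≤Y   : N * weight W X ≤ N * weight W Y + L * N ^ length X
    Y≤X   : N * weight W Y ≤ N * weight W X + L * N ^ length X

nearTie? : ∀ N D L X Y (W : A → ℕ) → Dec (NearTie N D L X Y W)
nearTie? N D L X Y W with All.all? (λ c → N ℕ.≤? D * W c) X | _ ℕ.≤? _ | _ ℕ.≤? _
... | no ¬p | _     | _     = no (¬p ∘ NearTie.large)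
... | yes _ | no ¬q | _     = no (¬q ∘ NearTie.X≤Y)
... | yes _ | yes _ | no ¬r = no (¬r ∘ NearTie.Y≤X)
... | yes p | yes q | yes r = yes (nearTie p q r)

nearTie-resp : ∀ {N D L} {X Y : List A} {W V} → W ≗ V → NearTie N D L X Y W → NearTie N D L X Y V
nearTie-resp {N = N} {D} {L} {X} {Y} {W} {V} W≗V (nearTie p q r) = nearTie
  (All.map (λ {c} h → subst (λ w → N ≤ D * w) (W≗V c) h) p)
  (subst₂′ (weight-cong X) (weight-cong Y) q) (subst₂′ (weight-cong Y) (weight-cong X) r)
  where
  weight-cong : ∀ cs → weight W cs ≡ weight V cs
  weight-cong cs = cong product (List.map-cong W≗V cs)
  subst₂′ : ∀ {a b c d e} → a ≡ b → c ≡ d → N * a ≤ N * c + e → N * b ≤ N * d + e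
  subst₂′ refl refl h = h

-- From `W` to `V` the weight of `X` grows by at least `τ` times the product of its other factors,
-- which is at least `(N / D) ^ pred (length X)`, while the weight of `Y` does not grow. The two
-- ties absorb only one error `L` each, whence `L + L`.
nearTie-separated : ∀ {N D L τ} {X Y : List A} {W V} .{{_ : NonZero N}} →
  NearTie N D L X Y W → NearTie N D L X Y V →
  All (λ c → W c ≤ V c) X → All (λ c → V c ≤ W c) Y →
  ∀ {e} → e ∈ X → W e + τ ≤ V e → τ ≤ D ^ pred (length X) * (L + L)
nearTie-separated {N = N} {D} {L} {τ} {X} {Y} {W} {V} w v X≤ Y≤ {e} e∈ gap
  with ds , p ← ∈⇒↭∷ e∈
  with W-ds≤ ← weight-mono (All.tail (↭.All-resp-↭ p X≤)) | large ← All.tail (↭.All-resp-↭ p (NearTie.large w))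
  rewrite ↭.↭-length p
  = ℕ.*-cancelʳ-≤ τ _ (N * N ^ l) {{ℕ.m^n≢0 N (suc l)}} (begin
    τ * (N * N ^ l)                          ≤⟨ ℕ.*-monoʳ-≤ τ (ℕ.*-monoʳ-≤ N (^-≤-weight large)) ⟩
    τ * (N * (D ^ l * π))                    ≡⟨ solve 4 (λ t n d p → t :* (n :* (d :* p)) := d :* (n :* (t :* p))) refl τ N (D ^ l) π ⟩
    D ^ l * (N * (τ * π))                    ≤⟨ ℕ.*-monoʳ-≤ (D ^ l) Nτπ≤ ⟩
    D ^ l * ((L + L) * (N * N ^ l))          ≡⟨ ℕ.*-assoc (D ^ l) (L + L) _ ⟨
    D ^ l * (L + L) * (N * N ^ l)            ∎)
  where
  open ≤-Reasoning
  open ℕ-Solver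
  l = length ds
  π = weight W ds
  len : length X ≡ suc l
  len = ↭.↭-length p
  α+ : weight W X + τ * π ≤ weight V X
  α+ = begin
    weight W X + τ * π               ≡⟨ cong (_+ τ * π) (weight-↭ W p) ⟩
    W e * π + τ * π                  ≡⟨ ℕ.*-distribʳ-+ π (W e) τ ⟨
    (W e + τ) * π                    ≤⟨ ℕ.*-mono-≤ gap W-ds≤ ⟩
    V e * weight V ds                ≡⟨ weight-↭ V p ⟨
    weight V X                       ∎
  Nτπ≤ : N * (τ * π) ≤ (L + L) * (N * N ^ l)
  Nτπ≤ = ℕ.+-cancelˡ-≤ (N * weight W X) _ _ (begin
    N * weight W X + N * (τ * π)     ≡⟨ ℕ.*-distribˡ-+ N _ _ ⟨
    N * (weight W X + τ * π)         ≤⟨ ℕ.*-monoʳ-≤ N α+ ⟩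
    N * weight V X                   ≤⟨ NearTie.X≤Y v ⟩
    N * weight V Y + L * N ^ length X   ≤⟨ ℕ.+-monoˡ-≤ _ (ℕ.*-monoʳ-≤ N (weight-mono Y≤)) ⟩
    N * weight W Y + L * N ^ length X   ≤⟨ ℕ.+-monoˡ-≤ _ (NearTie.Y≤X w) ⟩
    N * weight W X + L * N ^ length X + L * N ^ length X   ≡⟨ cong (λ i → N * weight W X + L * N ^ i + L * N ^ i) len ⟩
    N * weight W X + L * N ^ suc l + L * N ^ suc l   ≡⟨ solve 3 (λ a l p → a :+ l :* p :+ l :* p := a :+ (l :+ l) :* p) refl (N * weight W X) L (N ^ suc l) ⟩
    N * weight W X + (L + L) * (N * N ^ l) ∎)

∑ : ∀ {m} → (Fin m → ℕ) → ℕ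
∑ = Vector.foldr _+_ 0

∑≤max : ∀ {m} (f : Fin (suc m) → ℕ) → ∃[ j ] ∑ f ≤ suc m * f j
∑≤max {zero}  f = zero , ℕ.≤-refl
∑≤max {suc m} f with j , h ← ∑≤max (f ∘ suc) with ℕ.≤-total (f zero) (f (suc j))
... | inj₁ f0≤ = suc j , ℕ.+-mono-≤ f0≤ h
... | inj₂ ≤f0 = zero , ℕ.+-monoʳ-≤ (f zero) (ℕ.≤-trans h (ℕ.*-monoʳ-≤ (suc m) ≤f0))

-- The largest of the `suc k` entries of a row is at least `N / suc k`; start in the best initial
-- state and always take the best transition.
greedy : ∀ {W : Cell (suc k) → ℕ} {N} → (∀ r → N ≤ ∑ (λ j → W (r , j))) → ∀ n →
  Σ (Sequence (suc k) n) λ t → N ^ suc n ≤ suc k ^ suc n * weight W (cells t)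
greedy {k} {W} {N} rows n = t , subst (λ l → N ^ l ≤ suc k ^ l * weight W (cells t)) (length-cells t) (^-≤-weight large)
  where
  best : Fin (suc (suc k)) → Fin (suc k)
  best r = proj₁ (∑≤max λ j → W (r , j))
  best-large : ∀ r → N ≤ suc k * W (r , best r)
  best-large r = ℕ.≤-trans (rows r) (proj₂ (∑≤max λ j → W (r , j)))
  follow : Fin (suc k) → ∀ n → Sequence (suc k) n
  follow i zero    = i ∷ []
  follow i (suc n) = i ∷ follow (best (suc i)) n
  follow-large : ∀ i n → All (λ c → N ≤ suc k * W c) (transitionCells (transitions (follow i n)))
  follow-large i zero = []
  follow-large i (suc zero) = best-large (suc i) ∷ []
  follow-large i (suc (suc n)) = best-large (suc i) ∷ follow-large (best (suc i)) (suc n)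
  t = follow (best zero) n
  head-follow : ∀ i n → head (follow i n) ≡ i
  head-follow i zero    = refl
  head-follow i (suc n) = refl
  large : All (λ c → N ≤ suc k * W c) (cells t)
  large = subst (λ i → N ≤ suc k * W (zero , i)) (sym (head-follow _ n)) (best-large zero) ∷ follow-large (best zero) n

module _ {W : Cell (suc k) → ℕ} {N L : ℕ} .{{N≢0 : NonZero N}} {s : Sequence (suc k) n}
  (rows : ∀ r → N ≤ ∑ (λ j → W (r , j)))
  (optimal : ∀ (t : Sequence (suc k) n) → weight W (cells t) ≤ weight W (cells s) + L * N ^ n)
  (N-large : 2 * (suc k ^ suc n * L) ≤ N)
  where
  private
    open ≤-Reasoning
    K = suc k ^ suc n

  -- The greedy sequence is compared with `s` twice over: `N-large` makes the doubled slack at most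
  -- one copy of `N ^ suc n`, and the other copy remains. Hence the factor 2.
  nearOptimal-large : N ^ suc n ≤ 2 * K * weight W (cells s)
  nearOptimal-large = ℕ.+-cancelʳ-≤ (N ^ suc n) _ _ (begin
    N ^ suc n + N ^ suc n                                  ≤⟨ ℕ.+-mono-≤ (proj₂ gr) (proj₂ gr) ⟩
    K * weight W (cells t) + K * weight W (cells t)        ≡⟨ solve 2 (λ k w → k :* w :+ k :* w := con 2 :* k :* w) refl K (weight W (cells t)) ⟩
    2 * K * weight W (cells t)                             ≤⟨ ℕ.*-monoʳ-≤ (2 * K) (optimal t) ⟩
    2 * K * (weight W (cells s) + L * N ^ n)               ≡⟨ solve 4 (λ k w l p → con 2 :* k :* (w :+ l :* p) := con 2 :* k :* w :+ con 2 :* (k :* l) :* p) refl K (weight W (cells s)) L (N ^ n) ⟩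
    2 * K * weight W (cells s) + 2 * (K * L) * N ^ n       ≤⟨ ℕ.+-monoʳ-≤ (2 * K * weight W (cells s)) (ℕ.*-monoˡ-≤ (N ^ n) N-large) ⟩
    2 * K * weight W (cells s) + N ^ suc n                 ∎)
    where
    open ℕ-Solver
    gr = greedy {W = W} rows n
    t = proj₁ gr

  -- Comparison with `s₊` bounds the weight of `X` by that of `Y`, comparison with `s₋` does the
  -- converse. Cancelling the common part `C` costs the factor `2 * K` by which `s` may miss the
  -- maximal conceivable weight.
  nearOptimal⇒nearTie : (∀ c → W c ≤ N) → ∀ {s₊ s₋ : Sequence (suc k) n} C X Y →
    cells s ↭ C ++ X ++ Y → cells s₊ ↭ C ++ X ++ X → cells s₋ ↭ C ++ Y ++ Y → length X ≡ length Y →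
    NearTie N (2 * K) (2 * K * L) X Y W
  nearOptimal⇒nearTie W≤ {s₊} {s₋} C X Y p p₊ p₋ len = nearTie
    (All.tabulate λ c∈ → factor-large {D = 2 * K} W≤ (length-cells s) nearOptimal-large
      (↭.∈-resp-↭ (↭-sym p) (∈-++⁺ʳ C (∈-++⁺ˡ c∈))))
    (balance {D = 2 * K} {L} {length X} {n} {ρ} (subst (λ w → N ^ suc n ≤ 2 * K * w) s≡ nearOptimal-large)
      (subst (λ l → β ≤ N ^ l) (sym len) (weight-≤-^ W≤ Y))
      (subst₂≤ (weight₃ {X} {X} p₊) s≡ (optimal s₊)))
    (balance {D = 2 * K} {L} {length X} {n} {ρ} (subst (λ w → N ^ suc n ≤ 2 * K * w) s≡′ nearOptimal-large)
      (weight-≤-^ W≤ X)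
      (subst₂≤ (weight₃ {Y} {Y} p₋) s≡′ (optimal s₋)))
    where
    ρ = weight W C
    α = weight W X
    β = weight W Y
    weight₃ : ∀ {F G : List (Cell (suc k))} {t : Sequence (suc k) n} → cells t ↭ C ++ F ++ G →
      weight W (cells t) ≡ ρ * (weight W F * weight W G)
    weight₃ {F} {G} q = trans (weight-↭ W q) (trans (weight-++ W C (F ++ G)) (cong (ρ *_) (weight-++ W F G)))
    s≡ : weight W (cells s) ≡ ρ * (α * β)
    s≡ = weight₃ {X} {Y} {s} p
    s≡′ : weight W (cells s) ≡ ρ * (β * α)
    s≡′ = trans s≡ (cong (ρ *_) (ℕ.*-comm α β))
    subst₂≤ : ∀ {a b c d e} → a ≡ b → c ≡ d → a ≤ c + e → b ≤ d + e
    subst₂≤ refl refl h = h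

-- Rational arithmetic

-- Recursion on the natural number makes the homomorphism and order laws simple inductions, without
-- normalised fractions.
ι : ℕ → ℚ
ι zero    = 0ℚ
ι (suc n) = 1ℚ ℚ.+ ι n

ι-+ : ∀ m n → ι (m + n) ≡ ι m ℚ.+ ι n
ι-+ zero    n = sym (ℚ.+-identityˡ (ι n))
ι-+ (suc m) n = trans (cong (1ℚ ℚ.+_) (ι-+ m n)) (sym (ℚ.+-assoc 1ℚ (ι m) (ι n)))

ι-* : ∀ m n → ι (m * n) ≡ ι m ℚ.* ι n
ι-* zero    n = sym (ℚ.*-zeroˡ (ι n))
ι-* (suc m) n = begin
  ι (n + m * n)                    ≡⟨ ι-+ n (m * n) ⟩
  ι n ℚ.+ ι (m * n)                ≡⟨ cong₂ ℚ._+_ (sym (ℚ.*-identityˡ (ι n))) (ι-* m n) ⟩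
  1ℚ ℚ.* ι n ℚ.+ ι m ℚ.* ι n       ≡⟨ ℚ.*-distribʳ-+ (ι n) 1ℚ (ι m) ⟨
  (1ℚ ℚ.+ ι m) ℚ.* ι n             ∎
  where open ≡-Reasoning

0≤1 : 0ℚ ℚ.≤ 1ℚ
0≤1 = ℚ.nonNegative⁻¹ 1ℚ

0<1 : 0ℚ ℚ.< 1ℚ
0<1 = ℚ.positive⁻¹ 1ℚ

0≤ι : ∀ n → 0ℚ ℚ.≤ ι n
0≤ι zero    = ℚ.≤-refl
0≤ι (suc n) = ℚ.+-mono-≤ 0≤1 (0≤ι n)

0<ι-suc : ∀ n → 0ℚ ℚ.< ι (suc n)
0<ι-suc n = ℚ.+-mono-<-≤ 0<1 (0≤ι n)

ι-mono-≤ : ∀ {m n} → m ≤ n → ι m ℚ.≤ ι n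
ι-mono-≤ {n = n} z≤n       = 0≤ι n
ι-mono-≤         (s≤s m≤n) = ℚ.+-monoʳ-≤ 1ℚ (ι-mono-≤ m≤n)

ι-<-suc : ∀ n → ι n ℚ.< ι (suc n)
ι-<-suc n = subst (ℚ._< ι (suc n)) (ℚ.+-identityˡ (ι n)) (ℚ.+-monoˡ-< (ι n) 0<1)

ι-cancel-≤ : ∀ {m n} → ι m ℚ.≤ ι n → m ≤ n
ι-cancel-≤ {m} {n} ιm≤ιn = ℕ.≮⇒≥ λ n<m →
  ℚ.<-irrefl refl (ℚ.<-≤-trans (ι-<-suc n) (ℚ.≤-trans (ι-mono-≤ n<m) ιm≤ιn))

toℚᵘ-ι : ∀ n → toℚᵘ (ι n) ℚᵘ.≃ ℚᵘ.mkℚᵘ (pos n) 0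
toℚᵘ-ι zero    = ℚᵘ.≃-refl
toℚᵘ-ι (suc n) = ℚᵘ.≃-trans (ℚ.toℚᵘ-homo-+ 1ℚ (ι n)) (ℚᵘ.≃-trans (ℚᵘ.+-congʳ ℚᵘ.1ℚᵘ (toℚᵘ-ι n))
  (ℚᵘ.*≡* (cong (ℤ._* (pos 1)) (cong (ℤ._+_ (pos 1)) (ℤ.*-identityʳ (pos n))))))

-- A nonnegative fraction is at most its numerator.
archimedean : ∀ q → ∃[ n ] q ℚ.≤ ι n
archimedean q@(mkℚ (pos n) d-1 _) = n , ℚ.toℚᵘ-cancel-≤ (ℚᵘ.≤-trans (ℚᵘ.*≤* (ℤ.*-monoˡ-≤-nonNeg (pos n) (ℤ.+≤+ (s≤s z≤n))))
  (ℚᵘ.≤-reflexive (ℚᵘ.≃-sym (toℚᵘ-ι n))))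
archimedean q@(mkℚ -[1+ n ] d-1 _) = 0 , ℚ.nonPositive⁻¹ q

*-monoˡ-≤ : ∀ {a b c} → 0ℚ ℚ.≤ c → a ℚ.≤ b → c ℚ.* a ℚ.≤ c ℚ.* b
*-monoˡ-≤ {c = c} 0≤c = ℚ.*-monoˡ-≤-nonNeg c {{ℚ.nonNegative 0≤c}}

*-monoʳ-≤ : ∀ {a b c} → 0ℚ ℚ.≤ c → a ℚ.≤ b → a ℚ.* c ℚ.≤ b ℚ.* c
*-monoʳ-≤ {c = c} 0≤c = ℚ.*-monoʳ-≤-nonNeg c {{ℚ.nonNegative 0≤c}}

*-mono-≤ : ∀ {a b c d} → 0ℚ ℚ.≤ b → 0ℚ ℚ.≤ c → a ℚ.≤ b → c ℚ.≤ d → a ℚ.* c ℚ.≤ b ℚ.* d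
*-mono-≤ 0≤b 0≤c a≤b c≤d = ℚ.≤-trans (*-monoʳ-≤ 0≤c a≤b) (*-monoˡ-≤ 0≤b c≤d)

0≤* : ∀ {a b} → 0ℚ ℚ.≤ a → 0ℚ ℚ.≤ b → 0ℚ ℚ.≤ a ℚ.* b
0≤* {a} {b} 0≤a 0≤b = subst (ℚ._≤ a ℚ.* b) (ℚ.*-zeroʳ a) (*-monoˡ-≤ 0≤a 0≤b)

mesh : ℕ → ℚ
mesh N = ℚ.1/_ (ι (suc N)) {{ℚ.pos⇒nonZero (ι (suc N)) {{ℚ.positive (0<ι-suc N)}}}}

ι-mesh : ∀ N → ι (suc N) ℚ.* mesh N ≡ 1ℚ
ι-mesh N = ℚ.*-inverseʳ (ι (suc N)) {{ℚ.pos⇒nonZero (ι (suc N)) {{ℚ.positive (0<ι-suc N)}}}}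

0<mesh : ∀ N → 0ℚ ℚ.< mesh N
0<mesh N = ℚ.positive⁻¹ (mesh N) {{ℚ.1/pos⇒pos (ι (suc N)) {{ℚ.positive (0<ι-suc N)}}}}

0≤mesh : ∀ N → 0ℚ ℚ.≤ mesh N
0≤mesh N = ℚ.<⇒≤ (0<mesh N)

mesh-small : ∀ Q N₀ {ε} → 0ℚ ℚ.< ε → ∃[ N ] (N₀ ≤ N × ι Q ℚ.* mesh N ℚ.< ε)
mesh-small Q N₀ {ε} 0<ε = N , ℕ.m≤n⊔m N₁ N₀ , (begin-strict
    ι Q ℚ.* mesh N                     ≡⟨ cong (ℚ._* mesh N) (sym (trans (cong (ε ℚ.*_) (ℚ.*-comm (ι Q) ε⁻¹)) (trans (sym (ℚ.*-assoc ε ε⁻¹ (ι Q))) (trans (cong (ℚ._* ι Q) εε⁻¹) (ℚ.*-identityˡ (ι Q)))))) ⟩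
    ε ℚ.* (ι Q ℚ.* ε⁻¹) ℚ.* mesh N     ≤⟨ *-monoʳ-≤ (0≤mesh N) (*-monoˡ-≤ (ℚ.<⇒≤ 0<ε) (ℚ.≤-trans (proj₂ bound) (ι-mono-≤ (ℕ.m≤m⊔n N₁ N₀)))) ⟩
    ε ℚ.* ι N ℚ.* mesh N               <⟨ ℚ.*-monoˡ-<-pos (mesh N) {{ℚ.positive (0<mesh N)}} (ℚ.*-monoʳ-<-pos ε {{ℚ.positive 0<ε}} (ι-<-suc N)) ⟩
    ε ℚ.* ι (suc N) ℚ.* mesh N         ≡⟨ ℚ.*-assoc ε (ι (suc N)) (mesh N) ⟩
    ε ℚ.* (ι (suc N) ℚ.* mesh N)       ≡⟨ cong (ε ℚ.*_) (ι-mesh N) ⟩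
    ε ℚ.* 1ℚ                           ≡⟨ ℚ.*-identityʳ ε ⟩
    ε                                  ∎)
  where
  open ℚ.≤-Reasoning
  ε⁻¹ : ℚ
  ε⁻¹ = ℚ.1/_ ε {{ℚ.pos⇒nonZero ε {{ℚ.positive 0<ε}}}}
  εε⁻¹ : ε ℚ.* ε⁻¹ ≡ 1ℚ
  εε⁻¹ = ℚ.*-inverseʳ ε {{ℚ.pos⇒nonZero ε {{ℚ.positive 0<ε}}}}
  bound = archimedean (ι Q ℚ.* ε⁻¹)
  N₁ = proj₁ bound
  N = N₁ ⊔ N₀

-- Null sets

volume? : ∀ {d} → Maybe (Box d) → ℚ
volume? = maybe Box.volume 0ℚ

partialVolume-≤ : ∀ {d} (B : BoxFamily d) J {V} → 0ℚ ℚ.≤ V → (∀ n → volume? (B n) ℚ.≤ V) →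
  (∀ n → J ≤ n → B n ≡ nothing) → ∀ n → partialVolume B n ℚ.≤ ι J ℚ.* V
partialVolume-≤ B J {V} 0≤V vol≤ beyond n = ℚ.≤-trans (truncated n) (*-monoʳ-≤ 0≤V (ι-mono-≤ (ℕ.m⊓n≤n n J)))
  where
  open ℚ.≤-Reasoning
  truncated : ∀ n → partialVolume B n ℚ.≤ ι (n ⊓ J) ℚ.* V
  truncated zero = ℚ.≤-reflexive (sym (ℚ.*-zeroˡ V))
  truncated (suc n) with ℕ.≤-total J n
  ... | inj₁ J≤n = begin
    partialVolume B n ℚ.+ volume? (B n)   ≡⟨ cong (λ b → partialVolume B n ℚ.+ volume? b) (beyond n J≤n) ⟩
    partialVolume B n ℚ.+ 0ℚ              ≡⟨ ℚ.+-identityʳ _ ⟩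
    partialVolume B n                     ≤⟨ truncated n ⟩
    ι (n ⊓ J) ℚ.* V                       ≡⟨ cong (λ m → ι m ℚ.* V) (ℕ.m≥n⇒m⊓n≡n J≤n) ⟩
    ι J ℚ.* V                             ≡⟨ cong (λ m → ι m ℚ.* V) (ℕ.m≥n⇒m⊓n≡n (ℕ.m≤n⇒m≤1+n J≤n)) ⟨
    ι (suc n ⊓ J) ℚ.* V                   ∎
  ... | inj₂ n≤J with ℕ.m≤n⇒m<n∨m≡n n≤J
  ...   | inj₂ refl = begin
    partialVolume B n ℚ.+ volume? (B n)   ≡⟨ cong (λ b → partialVolume B n ℚ.+ volume? b) (beyond n ℕ.≤-refl) ⟩
    partialVolume B n ℚ.+ 0ℚ              ≡⟨ ℚ.+-identityʳ _ ⟩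
    partialVolume B n                     ≤⟨ truncated n ⟩
    ι (n ⊓ n) ℚ.* V                       ≤⟨ *-monoʳ-≤ 0≤V (ι-mono-≤ (ℕ.⊓-monoˡ-≤ n (ℕ.n≤1+n n))) ⟩
    ι (suc n ⊓ n) ℚ.* V                   ∎
  ...   | inj₁ n<J = begin
    partialVolume B n ℚ.+ volume? (B n)   ≤⟨ ℚ.+-mono-≤ (truncated n) (vol≤ n) ⟩
    ι (n ⊓ J) ℚ.* V ℚ.+ V                 ≡⟨ cong (λ m → ι m ℚ.* V ℚ.+ V) (ℕ.m≤n⇒m⊓n≡m n≤J) ⟩
    ι n ℚ.* V ℚ.+ V                       ≡⟨ ℚ.+-comm (ι n ℚ.* V) V ⟩
    V ℚ.+ ι n ℚ.* V                       ≡⟨ cong (ℚ._+ ι n ℚ.* V) (ℚ.*-identityˡ V) ⟨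
    1ℚ ℚ.* V ℚ.+ ι n ℚ.* V                ≡⟨ ℚ.*-distribʳ-+ V 1ℚ (ι n) ⟨
    ι (suc n) ℚ.* V                       ≡⟨ cong (λ m → ι m ℚ.* V) (ℕ.m≤n⇒m⊓n≡m n<J) ⟨
    ι (suc n ⊓ J) ℚ.* V                   ∎

power : ℚ → ℕ → ℚ
power w zero    = 1ℚ
power w (suc d) = w ℚ.* power w d

0≤power : ∀ {w} d → 0ℚ ℚ.≤ w → 0ℚ ℚ.≤ power w d
0≤power zero    0≤w = 0≤1
0≤power (suc d) 0≤w = 0≤* 0≤w (0≤power d 0≤w)

foldr-*-const : ∀ {d} {f : Fin d → ℚ} {w} → (∀ i → f i ≡ w) → Vector.foldr ℚ._*_ 1ℚ f ≡ power w d
foldr-*-const {zero}  f≡ = refl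
foldr-*-const {suc d} f≡ = cong₂ ℚ._*_ (f≡ zero) (foldr-*-const (f≡ ∘ suc))

gridLower gridUpper : ℕ → ℕ → ℕ → ℚ
gridLower N K m = (ι m ℚ.- ι K) ℚ.* mesh N
gridUpper N K m = (ι m ℚ.+ ι K) ℚ.* mesh N

NearGrid : ℕ → ℕ → ℝ → ℕ → Set
NearGrid N K x m = fromℚ (gridLower N K m) ℝ.≤ x × x ℝ.≤ fromℚ (gridUpper N K m)

gridCube : ∀ {d} → ℕ → ℕ → (Fin d → ℕ) → Box d
gridCube N K g = record
  { lower = λ i → gridLower N K (g i) ; upper = λ i → gridUpper N K (g i)
  ; lower≤upper = λ i → *-monoʳ-≤ (0≤mesh N) (ℚ.+-monoʳ-≤ (ι (g i)) (ℚ.≤-trans (ℚ.neg-antimono-≤ (0≤ι K)) (0≤ι K))) }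

cubeWidth : ℕ → ℕ → ℚ
cubeWidth N K = (ι K ℚ.+ ι K) ℚ.* mesh N

0≤cubeWidth : ∀ N K → 0ℚ ℚ.≤ cubeWidth N K
0≤cubeWidth N K = 0≤* (ℚ.+-mono-≤ (0≤ι K) (0≤ι K)) (0≤mesh N)

gridCube-volume : ∀ {d} N K (g : Fin d → ℕ) → Box.volume (gridCube N K g) ≡ power (cubeWidth N K) d
gridCube-volume N K g = foldr-*-const λ i → solve 3 (λ m k h → (m :+ k) :* h :- (m :- k) :* h := (k :+ k) :* h) refl
  (ι (g i)) (ι K) (mesh N)
  where open ℚ-Solver

-- Recentres a cube from the grid point approximating `x` to the point chosen on the same grid line;
-- the tolerances add up.
NearGrid-shift : ∀ {N K x l m} → l ≤ m + K → m ≤ l + K → NearGrid N K x l → NearGrid N (K + K) x m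
NearGrid-shift {N} {K} {x} {l} {m} l≤ m≤ (lo , up) =
    (λ ε 0<ε → let M , h = lo ε 0<ε in M , λ n M≤n → ℚ.≤-trans lower≤ (h n M≤n))
  , (λ ε 0<ε → let M , h = up ε 0<ε in M , λ n M≤n → ℚ.≤-trans (h n M≤n) (ℚ.+-monoˡ-≤ ε upper≤))
  where
  open ℚ.≤-Reasoning
  open ℚ-Solver
  lower≤ : gridLower N (K + K) m ℚ.≤ gridLower N K l
  lower≤ = *-monoʳ-≤ (0≤mesh N) (begin
    ι m ℚ.- ι (K + K)                ≤⟨ ℚ.+-monoˡ-≤ (ℚ.- ι (K + K)) (ι-mono-≤ m≤) ⟩
    ι (l + K) ℚ.- ι (K + K)          ≡⟨ cong₂ ℚ._-_ (ι-+ l K) (ι-+ K K) ⟩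
    ι l ℚ.+ ι K ℚ.- (ι K ℚ.+ ι K)    ≡⟨ solve 2 (λ l k → l :+ k :- (k :+ k) := l :- k) refl (ι l) (ι K) ⟩
    ι l ℚ.- ι K                      ∎)
  upper≤ : gridUpper N K l ℚ.≤ gridUpper N (K + K) m
  upper≤ = *-monoʳ-≤ (0≤mesh N) (begin
    ι l ℚ.+ ι K                      ≤⟨ ℚ.+-monoˡ-≤ (ι K) (ι-mono-≤ l≤) ⟩
    ι (m + K) ℚ.+ ι K                ≡⟨ cong (ℚ._+ ι K) (ι-+ m K) ⟩
    ι m ℚ.+ ι K ℚ.+ ι K              ≡⟨ ℚ.+-assoc (ι m) (ι K) (ι K) ⟩
    ι m ℚ.+ (ι K ℚ.+ ι K)            ≡⟨ cong (ι m ℚ.+_) (ι-+ K K) ⟨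
    ι m ℚ.+ ι (K + K)                ∎)

-- Per dimension there are `N + 2` grid points and the width is `2 K / (N + 1)`; since
-- `N + 2 ≤ 2 (N + 1)`, the product is bounded independently of `N`.
total-volume : ∀ N K d → ι (suc (suc N) ^ d) ℚ.* power (cubeWidth N K) d ℚ.≤ ι ((2 * (K + K)) ^ d)
total-volume N K zero    = ℚ.≤-reflexive refl
total-volume N K (suc d) = begin
  ι (M * M ^ d) ℚ.* (w ℚ.* power w d)            ≡⟨ cong (ℚ._* (w ℚ.* power w d)) (ι-* M (M ^ d)) ⟩
  ι M ℚ.* ι (M ^ d) ℚ.* (w ℚ.* power w d)        ≡⟨ solve 4 (λ a b c d → a :* b :* (c :* d) := a :* c :* (b :* d)) refl (ι M) (ι (M ^ d)) w (power w d) ⟩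
  ι M ℚ.* w ℚ.* (ι (M ^ d) ℚ.* power w d)        ≤⟨ *-mono-≤ (0≤ι Q) (0≤* (0≤ι (M ^ d)) (0≤power d (0≤cubeWidth N K))) one (total-volume N K d) ⟩
  ι Q ℚ.* ι (Q ^ d)                              ≡⟨ ι-* Q (Q ^ d) ⟨
  ι (Q ^ suc d)                                  ∎
  where
  open ℚ.≤-Reasoning
  open ℚ-Solver
  M = suc (suc N)
  Q = 2 * (K + K)
  w = cubeWidth N K
  one : ι M ℚ.* w ℚ.≤ ι Q
  one = begin
    ι M ℚ.* w                                                 ≤⟨ *-monoʳ-≤ (0≤cubeWidth N K) (ι-mono-≤ M≤) ⟩
    ι (2 * suc N) ℚ.* ((ι K ℚ.+ ι K) ℚ.* mesh N)              ≡⟨ cong₂ (λ a b → a ℚ.* (b ℚ.* mesh N)) (ι-* 2 (suc N)) (sym (ι-+ K K)) ⟩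
    ι 2 ℚ.* ι (suc N) ℚ.* (ι (K + K) ℚ.* mesh N)              ≡⟨ solve 4 (λ a b c d → a :* b :* (c :* d) := a :* c :* (b :* d)) refl (ι 2) (ι (suc N)) (ι (K + K)) (mesh N) ⟩
    ι 2 ℚ.* ι (K + K) ℚ.* (ι (suc N) ℚ.* mesh N)              ≡⟨ cong (ι 2 ℚ.* ι (K + K) ℚ.*_) (ι-mesh N) ⟩
    ι 2 ℚ.* ι (K + K) ℚ.* 1ℚ                                  ≡⟨ ℚ.*-identityʳ _ ⟩
    ι 2 ℚ.* ι (K + K)                                         ≡⟨ ι-* 2 (K + K) ⟨
    ι Q                                                       ∎
    where
    M≤ : suc (suc N) ≤ 2 * suc N
    M≤ = s≤s (ℕ.≤-trans (s≤s (ℕ.m≤m+n N 0)) (ℕ.m≤n+m (suc (N + 0)) N))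

-- S N is a condition on the grid points of mesh 1/(N + 1).  A set all of whose points
-- are within O(1/N) of S N is null if S N is, up to O(1/N), a graph over the
-- coordinates other than c.
module _ {d : ℕ} {A : Vector ℝ (suc d) → Set} (c : Fin (suc d)) (K N₀ : ℕ)
  (S : ∀ N → (Fin (suc d) → Fin (suc (suc N))) → Set)
  (S? : ∀ N g → Dec (S N g))
  (S-resp : ∀ {N g g′} → g ≗ g′ → S N g → S N g′)
  (separated : ∀ {N g g′} → S N g → S N g′ → (∀ i → i ≢ c → g i ≡ g′ i) → toℕ (g c) ≤ toℕ (g′ c) + K)
  (approximated : ∀ {N x} → N₀ ≤ N → A x → ∃[ g ] (S N g × (∀ i → NearGrid N K (x i) (toℕ (g i)))))
  where
  private
    Index : ℕ → Set
    Index N = Fin (suc (suc N) ^ d)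

    point : ∀ {N} → Index N → Fin (suc (suc N)) → Fin (suc d) → Fin (suc (suc N))
    point j t = insertAt (finToFun j) c t

    -- One cube for each grid line in direction `c`, around any point of `S` on that line.
    -- Decidability of `S` picks the point, and `separated` keeps the other points of `S` on the
    -- line within `K` steps of it.
    cube : ∀ N → Index N → Maybe (Box (suc d))
    cube N j with Fin.any? (λ t → S? N (point j t))
    ... | yes (t , _) = just (gridCube N (K + K) (toℕ ∘ point j t))
    ... | no  _       = nothing

    family : ∀ N → BoxFamily (suc d)
    family N j with j ℕ.<? suc (suc N) ^ d
    ... | yes j< = cube N (fromℕ< j<)
    ... | no  _  = nothing

    width : ℕ → ℚ
    width N = cubeWidth N (K + K)

    cube-volume : ∀ N j → volume? (cube N j) ℚ.≤ power (width N) (suc d)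
    cube-volume N j with Fin.any? (λ t → S? N (point j t))
    ... | yes (t , _) = ℚ.≤-reflexive (gridCube-volume N (K + K) (toℕ ∘ point j t))
    ... | no  _       = 0≤power (suc d) (0≤cubeWidth N (K + K))

    family-volume : ∀ N j → volume? (family N j) ℚ.≤ power (width N) (suc d)
    family-volume N j with j ℕ.<? suc (suc N) ^ d
    ... | yes j< = cube-volume N (fromℕ< j<)
    ... | no  _  = 0≤power (suc d) (0≤cubeWidth N (K + K))

    family-beyond : ∀ N j → suc (suc N) ^ d ≤ j → family N j ≡ nothing
    family-beyond N j ≤j with j ℕ.<? suc (suc N) ^ d
    ... | yes j< = contradiction j< (ℕ.≤⇒≯ ≤j)
    ... | no  _  = refl

    family-toℕ : ∀ N (j : Index N) → family N (toℕ j) ≡ cube N j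
    family-toℕ N j with toℕ j ℕ.<? suc (suc N) ^ d
    ... | yes j< = cong (cube N) (Fin.fromℕ<-toℕ j j<)
    ... | no  j≮ = contradiction (Fin.toℕ<n j) j≮

    point-cong : ∀ {N} (g : Fin (suc d) → Fin (suc (suc N))) t i → i ≢ c → point (funToFin (removeAt g c)) t i ≡ g i
    point-cong g t i i≢c = subst (λ i → point (funToFin (removeAt g c)) t i ≡ g i) (Fin.punchIn-punchOut (i≢c ∘ sym))
      (trans (insertAt-punchIn _ c t _) (Fin.finToFun-funToFin (removeAt g c) _))

    cube-covers : ∀ N {x g} → S N g → (∀ i → NearGrid N K (x i) (toℕ (g i))) →
      Maybe.Any (x ∈ᵇ_) (cube N (funToFin (removeAt g c)))
    cube-covers N {x} {g} Sg near with Fin.any? (λ t → S? N (point (funToFin (removeAt g c)) t))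
    ... | no ¬∃ = contradiction (g c , S-resp g≗ Sg) ¬∃
      where
      g≗ : g ≗ point (funToFin (removeAt g c)) (g c)
      g≗ i with i Fin.≟ c
      ... | yes refl = sym (insertAt-lookup _ c (g c))
      ... | no  i≢c  = sym (point-cong g (g c) i i≢c)
    ... | yes (t , St) = just λ i → NearGrid-shift {N} {x = x i} (proj₁ (close i)) (proj₂ (close i)) (near i)
      where
      p = point (funToFin (removeAt g c)) t
      close : ∀ i → toℕ (g i) ≤ toℕ (p i) + K × toℕ (p i) ≤ toℕ (g i) + K
      close i with i Fin.≟ c
      ... | yes refl = separated Sg St (λ i i≢c → sym (point-cong g t i i≢c)) , separated St Sg (point-cong g t)
      ... | no  i≢c rewrite point-cong g t i i≢c = ℕ.m≤m+n _ K , ℕ.m≤m+n _ K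

  approximated-by-graph⇒null : ¬ PositiveMeasure A
  approximated-by-graph⇒null (ε , 0<ε , ε≤) = ℚ.<-irrefl refl (ℚ.≤-<-trans
      (ε≤ (family N) covers _ (partialVolume-≤ (family N) J (0≤power (suc d) 0≤w) (family-volume N) (family-beyond N)))
      (ℚ.≤-<-trans total small))
    where
    open ℚ.≤-Reasoning
    open ℚ-Solver
    K₂ = K + K
    R = (2 * (K₂ + K₂)) ^ d
    choice = mesh-small (R * (K₂ + K₂)) N₀ 0<ε
    N = proj₁ choice
    small = proj₂ (proj₂ choice)
    J = suc (suc N) ^ d
    w = width N
    0≤w = 0≤cubeWidth N K₂
    -- The lines are indexed by `d` coordinates but the cubes have dimension `suc d`; the factor `w`
    -- left over is of order `1/N`.
    total : ι J ℚ.* power w (suc d) ℚ.≤ ι (R * (K₂ + K₂)) ℚ.* mesh N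
    total = begin
      ι J ℚ.* (w ℚ.* power w d)                       ≡⟨ solve 3 (λ a b c → a :* (b :* c) := a :* c :* b) refl (ι J) w (power w d) ⟩
      ι J ℚ.* power w d ℚ.* w                         ≤⟨ *-monoʳ-≤ 0≤w (total-volume N K₂ d) ⟩
      ι R ℚ.* ((ι K₂ ℚ.+ ι K₂) ℚ.* mesh N)            ≡⟨ ℚ.*-assoc (ι R) _ (mesh N) ⟨
      ι R ℚ.* (ι K₂ ℚ.+ ι K₂) ℚ.* mesh N              ≡⟨ cong (λ q → ι R ℚ.* q ℚ.* mesh N) (ι-+ K₂ K₂) ⟨
      ι R ℚ.* ι (K₂ + K₂) ℚ.* mesh N                  ≡⟨ cong (ℚ._* mesh N) (ι-* R (K₂ + K₂)) ⟨
      ι (R * (K₂ + K₂)) ℚ.* mesh N                    ∎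
    covers : family N Covers A
    covers x Ax with g , Sg , near ← approximated (proj₁ (proj₂ choice)) Ax =
      toℕ j , subst (Maybe.Any (x ∈ᵇ_)) (sym (family-toℕ N j)) (cube-covers N {x} {g} Sg near)
      where j = funToFin (removeAt g c)

-- Estimates with absolute values

p≤∣p∣ : ∀ p → p ℚ.≤ ℚ.∣ p ∣
p≤∣p∣ p with ℚ.≤-total 0ℚ p
... | inj₁ 0≤p = ℚ.≤-reflexive (sym (ℚ.0≤p⇒∣p∣≡p 0≤p))
... | inj₂ p≤0 = ℚ.≤-trans p≤0 (ℚ.0≤∣p∣ p)

∣-∣-sym : ∀ p q → ℚ.∣ p ℚ.- q ∣ ≡ ℚ.∣ q ℚ.- p ∣
∣-∣-sym p q = trans (sym (ℚ.∣-p∣≡∣p∣ (p ℚ.- q))) (cong ℚ.∣_∣ (solve 2 (λ p q → :- (p :- q) := q :- p) refl p q))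
  where open ℚ-Solver

∣-∣≤⇒≤ : ∀ {p q r} → ℚ.∣ p ℚ.- q ∣ ℚ.≤ r → p ℚ.≤ q ℚ.+ r
∣-∣≤⇒≤ {p} {q} {r} h = begin
  p                       ≡⟨ solve 2 (λ p q → p := q :+ (p :- q)) refl p q ⟩
  q ℚ.+ (p ℚ.- q)         ≤⟨ ℚ.+-monoʳ-≤ q (ℚ.≤-trans (p≤∣p∣ (p ℚ.- q)) h) ⟩
  q ℚ.+ r                 ∎
  where
  open ℚ.≤-Reasoning
  open ℚ-Solver

∣-∣≤⇒≥ : ∀ {p q r} → ℚ.∣ p ℚ.- q ∣ ℚ.≤ r → q ℚ.≤ p ℚ.+ r
∣-∣≤⇒≥ {p} {q} h = ∣-∣≤⇒≤ (subst (ℚ._≤ _) (∣-∣-sym p q) h)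

≤⇒-≤ : ∀ {p q r} → p ℚ.≤ q ℚ.+ r → p ℚ.- q ℚ.≤ r
≤⇒-≤ {p} {q} {r} h = begin
  p ℚ.- q             ≤⟨ ℚ.+-monoˡ-≤ (ℚ.- q) h ⟩
  q ℚ.+ r ℚ.- q       ≡⟨ solve 2 (λ q r → q :+ r :- q := r) refl q r ⟩
  r                   ∎
  where
  open ℚ.≤-Reasoning
  open ℚ-Solver

≤⇒∣-∣≤ : ∀ {p q r} → p ℚ.≤ q ℚ.+ r → q ℚ.≤ p ℚ.+ r → ℚ.∣ p ℚ.- q ∣ ℚ.≤ r
≤⇒∣-∣≤ {p} {q} {r} h h′ with ℚ.∣p∣≡p∨∣p∣≡-p (p ℚ.- q)
... | inj₁ eq = subst (ℚ._≤ r) (sym eq) (≤⇒-≤ h)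
... | inj₂ eq = subst (ℚ._≤ r) (sym (trans eq (solve 2 (λ p q → :- (p :- q) := q :- p) refl p q))) (≤⇒-≤ h′)
  where open ℚ-Solver

-- Products of perturbed factors

prodℚ : ∀ {A : Set} → (A → ℚ) → List A → ℚ
prodℚ y []       = 1ℚ
prodℚ y (c ∷ cs) = y c ℚ.* prodℚ y cs

prodℚ-scale : ∀ {A : Set} P (q : A → ℚ) cs → prodℚ (λ c → ι P ℚ.* q c) cs ≡ ι (P ^ length cs) ℚ.* prodℚ q cs
prodℚ-scale P q [] = refl
prodℚ-scale P q (c ∷ cs) = begin
  ι P ℚ.* q c ℚ.* prodℚ (λ c → ι P ℚ.* q c) cs            ≡⟨ cong (ι P ℚ.* q c ℚ.*_) (prodℚ-scale P q cs) ⟩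
  ι P ℚ.* q c ℚ.* (ι (P ^ length cs) ℚ.* prodℚ q cs)      ≡⟨ solve 4 (λ a b c d → a :* b :* (c :* d) := a :* c :* (b :* d)) refl (ι P) (q c) (ι (P ^ length cs)) (prodℚ q cs) ⟩
  ι P ℚ.* ι (P ^ length cs) ℚ.* (q c ℚ.* prodℚ q cs)      ≡⟨ cong (ℚ._* (q c ℚ.* prodℚ q cs)) (ι-* P (P ^ length cs)) ⟨
  ι (P * P ^ length cs) ℚ.* (q c ℚ.* prodℚ q cs)          ∎
  where
  open ≡-Reasoning
  open ℚ-Solver

-- The recursion solves to `(1 + r)^l - 1`.
productError : ℕ → ℕ → ℕ
productError r zero    = 0
productError r (suc l) = r * suc (productError r l) + productError r l

productError-step : ∀ P r e p → P * (r * (suc e * p)) + P * (e * p) ≡ (r * suc e + e) * (P * p)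
productError-step = solve 4 (λ P r e p →
  P :* (r :* ((con 1 :+ e) :* p)) :+ P :* (e :* p) := (r :* (con 1 :+ e) :+ e) :* (P :* p)) refl
  where open ℕ-Solver

-- Induction on the splitting `xX - wV = (x - w) X + w (X - V)`, with `X` estimated by `V` plus the
-- error already known. The factor `suc N` on the left stands for an error of order
-- `(N + 1)^(l - 1)`, also when `l` is 0.
product-perturbation : ∀ {A : Set} {y : A → ℚ} {W : A → ℕ} {r N} → (∀ c → ℚ.∣ y c ℚ.- ι (W c) ∣ ℚ.≤ ι r) →
  (∀ c → W c ≤ suc N) → ∀ cs →
  ι (suc N) ℚ.* ℚ.∣ prodℚ y cs ℚ.- ι (weight W cs) ∣ ℚ.≤ ι (productError r (length cs) * suc N ^ length cs)
product-perturbation {N = N} close W≤ [] = ℚ.≤-reflexive (ℚ.*-zeroʳ (ι (suc N)))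
product-perturbation {y = y} {W} {r} {N} close W≤ (c ∷ cs) = begin
  ιP ℚ.* ℚ.∣ yᶜ ℚ.* X ℚ.- ι (W c * V) ∣
    ≡⟨ cong (λ p → ιP ℚ.* ℚ.∣ yᶜ ℚ.* X ℚ.- p ∣) (ι-* (W c) V) ⟩
  ιP ℚ.* ℚ.∣ yᶜ ℚ.* X ℚ.- w ℚ.* ι V ∣
    ≡⟨ cong (λ p → ιP ℚ.* ℚ.∣ p ∣) (solve 4 (λ x X w V → x :* X :- w :* V := (x :- w) :* X :+ w :* (X :- V)) refl yᶜ X w (ι V)) ⟩
  ιP ℚ.* ℚ.∣ (yᶜ ℚ.- w) ℚ.* X ℚ.+ w ℚ.* (X ℚ.- ι V) ∣
    ≤⟨ *-monoˡ-≤ 0≤ιP (ℚ.∣p+q∣≤∣p∣+∣q∣ ((yᶜ ℚ.- w) ℚ.* X) (w ℚ.* (X ℚ.- ι V))) ⟩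
  ιP ℚ.* (ℚ.∣ (yᶜ ℚ.- w) ℚ.* X ∣ ℚ.+ ℚ.∣ w ℚ.* (X ℚ.- ι V) ∣)
    ≡⟨ cong (ιP ℚ.*_) (cong₂ ℚ._+_ (ℚ.∣p*q∣≡∣p∣*∣q∣ (yᶜ ℚ.- w) X) (trans (ℚ.∣p*q∣≡∣p∣*∣q∣ w (X ℚ.- ι V)) (cong (ℚ._* E) (ℚ.0≤p⇒∣p∣≡p (0≤ι (W c)))))) ⟩
  ιP ℚ.* (ℚ.∣ yᶜ ℚ.- w ∣ ℚ.* ℚ.∣ X ∣ ℚ.+ w ℚ.* E)
    ≡⟨ solve 5 (λ p a b w e → p :* (a :* b :+ w :* e) := p :* (a :* b) :+ w :* (p :* e)) refl ιP ℚ.∣ yᶜ ℚ.- w ∣ ℚ.∣ X ∣ w E ⟩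
  ιP ℚ.* (ℚ.∣ yᶜ ℚ.- w ∣ ℚ.* ℚ.∣ X ∣) ℚ.+ w ℚ.* (ιP ℚ.* E)
    ≤⟨ ℚ.+-mono-≤ (*-monoˡ-≤ 0≤ιP (*-mono-≤ (0≤ι r) (ℚ.0≤∣p∣ X) (close c) X≤))
         (*-mono-≤ 0≤ιP (0≤* 0≤ιP (ℚ.0≤∣p∣ _)) (ι-mono-≤ (W≤ c)) IH) ⟩
  ιP ℚ.* (ι r ℚ.* ι (suc e * Pˡ)) ℚ.+ ιP ℚ.* ι (e * Pˡ)
    ≡⟨ cong₂ ℚ._+_ (trans (cong (ιP ℚ.*_) (sym (ι-* r (suc e * Pˡ)))) (sym (ι-* P (r * (suc e * Pˡ))))) (sym (ι-* P (e * Pˡ))) ⟩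
  ι (P * (r * (suc e * Pˡ))) ℚ.+ ι (P * (e * Pˡ))
    ≡⟨ ι-+ (P * (r * (suc e * Pˡ))) (P * (e * Pˡ)) ⟨
  ι (P * (r * (suc e * Pˡ)) + P * (e * Pˡ))
    ≡⟨ cong ι (productError-step P r e Pˡ) ⟩
  ι ((r * suc e + e) * (P * Pˡ)) ∎
  where
  open ℚ.≤-Reasoning
  open ℚ-Solver
  P = suc N
  ιP = ι P
  0≤ιP = 0≤ι P
  yᶜ = y c
  w = ι (W c)
  X = prodℚ y cs
  V = weight W cs
  E = ℚ.∣ X ℚ.- ι V ∣
  e = productError r (length cs)
  Pˡ = P ^ length cs
  IH : ιP ℚ.* E ℚ.≤ ι (e * Pˡ)
  IH = product-perturbation close W≤ cs
  E≤ : E ℚ.≤ ι (e * Pˡ)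
  E≤ = ℚ.≤-trans (subst (ℚ._≤ ιP ℚ.* E) (ℚ.*-identityˡ E) (*-monoʳ-≤ {1ℚ} {ιP} (ℚ.0≤∣p∣ (X ℚ.- ι V)) (ι-mono-≤ {1} {P} (s≤s z≤n)))) IH
  X≤ : ℚ.∣ X ∣ ℚ.≤ ι (suc e * Pˡ)
  X≤ = begin
    ℚ.∣ X ∣                                 ≡⟨ cong ℚ.∣_∣ (solve 2 (λ X V → X := V :+ (X :- V)) refl X (ι V)) ⟩
    ℚ.∣ ι V ℚ.+ (X ℚ.- ι V) ∣               ≤⟨ ℚ.∣p+q∣≤∣p∣+∣q∣ (ι V) (X ℚ.- ι V) ⟩
    ℚ.∣ ι V ∣ ℚ.+ E                         ≡⟨ cong (ℚ._+ E) (ℚ.0≤p⇒∣p∣≡p (0≤ι V)) ⟩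
    ι V ℚ.+ E                               ≤⟨ ℚ.+-mono-≤ (ι-mono-≤ (weight-≤-^ W≤ cs)) E≤ ⟩
    ι Pˡ ℚ.+ ι (e * Pˡ)                     ≡⟨ ι-+ Pˡ (e * Pˡ) ⟨
    ι (suc e * Pˡ)                          ∎

-- Each of the two products contributes its `productError`, and the tolerance `mesh N`, scaled by
-- `suc N ^ suc l`, contributes one more `suc N ^ l`.
nearOptimal-scaled : ∀ {A : Set} {q : A → ℚ} {W : A → ℕ} {r N l} →
  (∀ c → ℚ.∣ ι (suc N) ℚ.* q c ℚ.- ι (W c) ∣ ℚ.≤ ι r) → (∀ c → W c ≤ suc N) →
  ∀ {cs ds} → length cs ≡ suc l → length ds ≡ suc l → prodℚ q cs ℚ.≤ prodℚ q ds ℚ.+ mesh N →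
  weight W cs ≤ weight W ds + suc (2 * productError r (suc l)) * suc N ^ l
nearOptimal-scaled {q = q} {W} {r} {N} {l} close W≤ {cs} {ds} lc ld h =
  ℕ.*-cancelˡ-≤ P (ι-cancel-≤ (begin
    ι (P * weight W cs)                                                         ≡⟨ ι-* P (weight W cs) ⟩
    ιP ℚ.* ι (weight W cs)                                                      ≤⟨ ∣-∣≤⇒≥ {ιP ℚ.* X cs} (err cs lc) ⟩
    ιP ℚ.* X cs ℚ.+ ι eP                                                        ≤⟨ ℚ.+-monoˡ-≤ (ι eP) X≤ ⟩
    ιP ℚ.* X ds ℚ.+ ι Pˡ ℚ.+ ι eP                                               ≤⟨ ℚ.+-monoˡ-≤ (ι eP) (ℚ.+-monoˡ-≤ (ι Pˡ) (∣-∣≤⇒≤ {ιP ℚ.* X ds} {ιP ℚ.* ι (weight W ds)} (err ds ld))) ⟩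
    ιP ℚ.* ι (weight W ds) ℚ.+ ι eP ℚ.+ ι Pˡ ℚ.+ ι eP                           ≡⟨ cong (λ z → z ℚ.+ ι eP ℚ.+ ι Pˡ ℚ.+ ι eP) (ι-* P (weight W ds)) ⟨
    ι (P * weight W ds) ℚ.+ ι eP ℚ.+ ι Pˡ ℚ.+ ι eP                              ≡⟨ ι-+₄ (P * weight W ds) eP Pˡ eP ⟨
    ι (P * weight W ds + eP + Pˡ + eP)                                          ≡⟨ cong ι (ℕ-ring P (weight W ds) e (P ^ l)) ⟩
    ι (P * (weight W ds + suc (2 * e) * P ^ l))                                 ∎))
  where
  open ℚ.≤-Reasoning
  P = suc N
  ιP = ι P
  Pˡ = P ^ suc l
  e = productError r (suc l)
  eP = e * Pˡ
  X : List _ → ℚ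
  X = prodℚ (λ c → ιP ℚ.* q c)
  err : ∀ cs → length cs ≡ suc l → ℚ.∣ ιP ℚ.* X cs ℚ.- ιP ℚ.* ι (weight W cs) ∣ ℚ.≤ ι eP
  err cs len = begin
    ℚ.∣ ιP ℚ.* X cs ℚ.- ιP ℚ.* ι (weight W cs) ∣    ≡⟨ cong ℚ.∣_∣ (solve 3 (λ p x y → p :* x :- p :* y := p :* (x :- y)) refl ιP (X cs) (ι (weight W cs))) ⟩
    ℚ.∣ ιP ℚ.* (X cs ℚ.- ι (weight W cs)) ∣         ≡⟨ ℚ.∣p*q∣≡∣p∣*∣q∣ ιP _ ⟩
    ℚ.∣ ιP ∣ ℚ.* ℚ.∣ X cs ℚ.- ι (weight W cs) ∣     ≡⟨ cong (ℚ._* ℚ.∣ X cs ℚ.- ι (weight W cs) ∣) (ℚ.0≤p⇒∣p∣≡p (0≤ι P)) ⟩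
    ιP ℚ.* ℚ.∣ X cs ℚ.- ι (weight W cs) ∣           ≤⟨ product-perturbation close W≤ cs ⟩
    ι (productError r (length cs) * P ^ length cs)  ≡⟨ cong (λ i → ι (productError r i * P ^ i)) len ⟩
    ι eP                                            ∎
    where open ℚ-Solver
  X≡ : ∀ cs → length cs ≡ suc l → X cs ≡ ι Pˡ ℚ.* prodℚ q cs
  X≡ cs len = trans (prodℚ-scale P q cs) (cong (λ i → ι (P ^ i) ℚ.* prodℚ q cs) len)
  X≤ : ιP ℚ.* X cs ℚ.≤ ιP ℚ.* X ds ℚ.+ ι Pˡ
  X≤ = begin
    ιP ℚ.* X cs                                             ≡⟨ cong (ιP ℚ.*_) (X≡ cs lc) ⟩
    ιP ℚ.* (ι Pˡ ℚ.* prodℚ q cs)                            ≤⟨ *-monoˡ-≤ (0≤ι P) (*-monoˡ-≤ (0≤ι Pˡ) h) ⟩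
    ιP ℚ.* (ι Pˡ ℚ.* (prodℚ q ds ℚ.+ mesh N))               ≡⟨ solve 4 (λ p s x h → p :* (s :* (x :+ h)) := p :* (s :* x) :+ s :* (p :* h)) refl ιP (ι Pˡ) (prodℚ q ds) (mesh N) ⟩
    ιP ℚ.* (ι Pˡ ℚ.* prodℚ q ds) ℚ.+ ι Pˡ ℚ.* (ιP ℚ.* mesh N) ≡⟨ cong₂ ℚ._+_ (cong (ιP ℚ.*_) (sym (X≡ ds ld))) (trans (cong (ι Pˡ ℚ.*_) (ι-mesh N)) (ℚ.*-identityʳ (ι Pˡ))) ⟩
    ιP ℚ.* X ds ℚ.+ ι Pˡ                                    ∎
    where open ℚ-Solver
  ι-+₄ : ∀ a b c d → ι (a + b + c + d) ≡ ι a ℚ.+ ι b ℚ.+ ι c ℚ.+ ι d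
  ι-+₄ a b c d = trans (ι-+ (a + b + c) d) (cong (ℚ._+ ι d) (trans (ι-+ (a + b) c) (cong (ℚ._+ ι c) (ι-+ a b))))
  ℕ-ring : ∀ P w e p → P * w + e * (P * p) + P * p + e * (P * p) ≡ P * (w + suc (2 * e) * p)
  ℕ-ring = solve 4 (λ P w e p → P :* w :+ e :* (P :* p) :+ P :* p :+ e :* (P :* p) := P :* (w :+ (con 1 :+ con 2 :* e) :* p)) refl
    where open ℕ-Solver

-- Rounding a chain to a grid

+-cancelˡ-≤ : ∀ {p q} r → r ℚ.+ p ℚ.≤ r ℚ.+ q → p ℚ.≤ q
+-cancelˡ-≤ {p} {q} r h = begin
  p                         ≡⟨ solve 2 (λ r p → p := :- r :+ (r :+ p)) refl r p ⟩
  ℚ.- r ℚ.+ (r ℚ.+ p)       ≤⟨ ℚ.+-monoʳ-≤ (ℚ.- r) h ⟩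
  ℚ.- r ℚ.+ (r ℚ.+ q)       ≡⟨ solve 2 (λ r p → p := :- r :+ (r :+ p)) refl r q ⟨
  q                         ∎
  where
  open ℚ.≤-Reasoning
  open ℚ-Solver

≤+ : ∀ p {q} → 0ℚ ℚ.≤ q → p ℚ.≤ p ℚ.+ q
≤+ p {q} 0≤q = subst (ℚ._≤ p ℚ.+ q) (ℚ.+-identityʳ p) (ℚ.+-monoʳ-≤ p 0≤q)

-- Rational approximants of a probability, scaled by `P`, may leave the interval from 0 to `P` on
-- either side. The search downwards from `P` clamps them to it, and the tolerance `suc c` pays for
-- the overshoot.
round : ∀ c P y → 0ℚ ℚ.≤ y ℚ.+ 1ℚ → y ℚ.≤ ι P ℚ.+ ι (suc c) →
  ∃[ g ] (g ≤ P × ℚ.∣ y ℚ.- ι g ∣ ℚ.≤ ι (suc c))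
round c zero y lo up = 0 , z≤n , ≤⇒∣-∣≤ up (ℚ.≤-trans lo (ℚ.+-monoʳ-≤ y (≤+ 1ℚ (0≤ι c))))
round c (suc P) y lo up with ι (suc P) ℚ.≤? y
... | yes P≤y = suc P , ℕ.≤-refl , ≤⇒∣-∣≤ up (ℚ.≤-trans P≤y (≤+ y (0≤ι (suc c))))
... | no  P≰y = let g , g≤ , close = round c P y lo y≤ in g , ℕ.m≤n⇒m≤1+n g≤ , close
  where
  open ℚ.≤-Reasoning
  y≤ : y ℚ.≤ ι P ℚ.+ ι (suc c)
  y≤ = begin
    y                      ≤⟨ ℚ.<⇒≤ (ℚ.≰⇒> P≰y) ⟩
    1ℚ ℚ.+ ι P             ≡⟨ ℚ.+-comm 1ℚ (ι P) ⟩
    ι P ℚ.+ 1ℚ             ≤⟨ ℚ.+-monoʳ-≤ (ι P) (≤+ 1ℚ (0≤ι c)) ⟩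
    ι P ℚ.+ ι (suc c)      ∎

∑ℚ : ∀ {m} → (Fin m → ℚ) → ℚ
∑ℚ = Vector.foldr ℚ._+_ 0ℚ

∑ℚ-scale : ∀ {m} p (f : Fin m → ℚ) → ∑ℚ (λ j → p ℚ.* f j) ≡ p ℚ.* ∑ℚ f
∑ℚ-scale {zero}  p f = sym (ℚ.*-zeroʳ p)
∑ℚ-scale {suc m} p f = trans (cong (p ℚ.* f zero ℚ.+_) (∑ℚ-scale p (f ∘ suc))) (sym (ℚ.*-distribˡ-+ p (f zero) _))

0≤∑ℚ+ : ∀ {m} {f : Fin m → ℚ} → (∀ j → 0ℚ ℚ.≤ f j ℚ.+ 1ℚ) → 0ℚ ℚ.≤ ∑ℚ f ℚ.+ ι m
0≤∑ℚ+ {zero}          f≥ = ℚ.≤-refl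
0≤∑ℚ+ {suc m} {f = f} f≥ = subst (0ℚ ℚ.≤_)
  (solve 4 (λ a b c d → a :+ b :+ (c :+ d) := a :+ c :+ (b :+ d)) refl (f zero) 1ℚ (∑ℚ (f ∘ suc)) (ι m))
  (ℚ.+-mono-≤ (f≥ zero) (0≤∑ℚ+ (f≥ ∘ suc)))
  where open ℚ-Solver

-- Entries may fall to `-1`, so the remaining terms can hide at most `m` below the sum.
term≤∑ℚ+ : ∀ {m} {f : Fin m → ℚ} → (∀ j → 0ℚ ℚ.≤ f j ℚ.+ 1ℚ) → ∀ j → f j ℚ.≤ ∑ℚ f ℚ.+ ι m
term≤∑ℚ+ {suc m} {f = f} f≥ zero = begin
  f zero                                              ≤⟨ ≤+ (f zero) (0≤∑ℚ+ (f≥ ∘ suc)) ⟩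
  f zero ℚ.+ (∑ℚ (f ∘ suc) ℚ.+ ι m)                   ≤⟨ ≤+ _ 0≤1 ⟩
  f zero ℚ.+ (∑ℚ (f ∘ suc) ℚ.+ ι m) ℚ.+ 1ℚ            ≡⟨ solve 4 (λ a b c d → a :+ (c :+ d) :+ b := a :+ c :+ (b :+ d)) refl (f zero) 1ℚ (∑ℚ (f ∘ suc)) (ι m) ⟩
  f zero ℚ.+ ∑ℚ (f ∘ suc) ℚ.+ ι (suc m)               ∎
  where
  open ℚ.≤-Reasoning
  open ℚ-Solver
term≤∑ℚ+ {suc m} {f = f} f≥ (suc j) = begin
  f (suc j)                                           ≤⟨ term≤∑ℚ+ (f≥ ∘ suc) j ⟩
  ∑ℚ (f ∘ suc) ℚ.+ ι m                                ≤⟨ ≤+ _ (f≥ zero) ⟩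
  ∑ℚ (f ∘ suc) ℚ.+ ι m ℚ.+ (f zero ℚ.+ 1ℚ)            ≡⟨ solve 4 (λ a b c d → c :+ d :+ (a :+ b) := a :+ c :+ (b :+ d)) refl (f zero) 1ℚ (∑ℚ (f ∘ suc)) (ι m) ⟩
  f zero ℚ.+ ∑ℚ (f ∘ suc) ℚ.+ ι (suc m)               ∎
  where
  open ℚ.≤-Reasoning
  open ℚ-Solver

∑-close : ∀ {m r} {f : Fin m → ℚ} {g : Fin m → ℕ} → (∀ j → ℚ.∣ f j ℚ.- ι (g j) ∣ ℚ.≤ ι r) →
  ℚ.∣ ∑ℚ f ℚ.- ι (∑ g) ∣ ℚ.≤ ι (m * r)
∑-close {zero}                  close = ℚ.≤-refl
∑-close {suc m} {r} {f} {g} close = begin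
  ℚ.∣ f zero ℚ.+ F ℚ.- ι (g zero + ∑ (g ∘ suc)) ∣            ≡⟨ cong (λ z → ℚ.∣ f zero ℚ.+ F ℚ.- z ∣) (ι-+ (g zero) (∑ (g ∘ suc))) ⟩
  ℚ.∣ f zero ℚ.+ F ℚ.- (ι (g zero) ℚ.+ G) ∣                  ≡⟨ cong ℚ.∣_∣ (solve 4 (λ a b c d → a :+ b :- (c :+ d) := (a :- c) :+ (b :- d)) refl (f zero) F (ι (g zero)) G) ⟩
  ℚ.∣ (f zero ℚ.- ι (g zero)) ℚ.+ (F ℚ.- G) ∣                ≤⟨ ℚ.∣p+q∣≤∣p∣+∣q∣ (f zero ℚ.- ι (g zero)) (F ℚ.- G) ⟩
  ℚ.∣ f zero ℚ.- ι (g zero) ∣ ℚ.+ ℚ.∣ F ℚ.- G ∣              ≤⟨ ℚ.+-mono-≤ (close zero) (∑-close {r = r} {f ∘ suc} {g ∘ suc} (close ∘ suc)) ⟩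
  ι r ℚ.+ ι (m * r)                                          ≡⟨ ι-+ r (m * r) ⟨
  ι (r + m * r)                                              ∎
  where
  open ℚ.≤-Reasoning
  open ℚ-Solver
  F = ∑ℚ (f ∘ suc)
  G = ι (∑ (g ∘ suc))

complement-close : ∀ {y S P G e} → ℚ.∣ y ℚ.+ S ℚ.- ι P ∣ ℚ.≤ 1ℚ → ℚ.∣ S ℚ.- ι G ∣ ℚ.≤ ι e → 0ℚ ℚ.≤ y ℚ.+ 1ℚ →
  ℚ.∣ y ℚ.- ι (P ∸ G) ∣ ℚ.≤ ι (suc e)
complement-close {y} {S} {P} {G} {e} total close y≥ = ≤⇒∣-∣≤ upper lower
  where
  open ℚ.≤-Reasoning
  open ℚ-Solver
  P≤ : ι P ℚ.≤ ι G ℚ.+ ι (P ∸ G)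
  P≤ = subst (ι P ℚ.≤_) (ι-+ G (P ∸ G)) (ι-mono-≤ (ℕ.m≤n+m∸n P G))
  upper : y ℚ.≤ ι (P ∸ G) ℚ.+ ι (suc e)
  upper = +-cancelˡ-≤ (ι G) (begin
    ι G ℚ.+ y                                    ≤⟨ ℚ.+-monoˡ-≤ y (∣-∣≤⇒≥ {S} close) ⟩
    S ℚ.+ ι e ℚ.+ y                              ≡⟨ solve 3 (λ s e y → s :+ e :+ y := y :+ s :+ e) refl S (ι e) y ⟩
    y ℚ.+ S ℚ.+ ι e                              ≤⟨ ℚ.+-monoˡ-≤ (ι e) (∣-∣≤⇒≤ {y ℚ.+ S} total) ⟩
    ι P ℚ.+ 1ℚ ℚ.+ ι e                           ≤⟨ ℚ.+-monoˡ-≤ (ι e) (ℚ.+-monoˡ-≤ 1ℚ P≤) ⟩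
    ι G ℚ.+ ι (P ∸ G) ℚ.+ 1ℚ ℚ.+ ι e             ≡⟨ solve 4 (λ g o u e → g :+ o :+ u :+ e := g :+ (o :+ (u :+ e))) refl (ι G) (ι (P ∸ G)) 1ℚ (ι e) ⟩
    ι G ℚ.+ (ι (P ∸ G) ℚ.+ ι (suc e))            ∎)
  lower : ι (P ∸ G) ℚ.≤ y ℚ.+ ι (suc e)
  lower with ℕ.≤-total G P
  -- If the rounded free entries exceed `P`, the subtraction is truncated to 0 and the lower bound
  -- on `y` takes over.
  ... | inj₂ P≤G = begin
    ι (P ∸ G)                ≡⟨ cong ι (ℕ.m≤n⇒m∸n≡0 P≤G) ⟩
    0ℚ                       ≤⟨ y≥ ⟩
    y ℚ.+ 1ℚ                 ≤⟨ ℚ.+-monoʳ-≤ y (≤+ 1ℚ (0≤ι e)) ⟩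
    y ℚ.+ ι (suc e)          ∎
  ... | inj₁ G≤P = +-cancelˡ-≤ (ι G) (begin
    ι G ℚ.+ ι (P ∸ G)                            ≡⟨ ι-+ G (P ∸ G) ⟨
    ι (G + (P ∸ G))                              ≡⟨ cong ι (ℕ.m+[n∸m]≡n G≤P) ⟩
    ι P                                          ≤⟨ ∣-∣≤⇒≥ {y ℚ.+ S} total ⟩
    y ℚ.+ S ℚ.+ 1ℚ                               ≤⟨ ℚ.+-monoˡ-≤ 1ℚ (ℚ.+-monoʳ-≤ y (∣-∣≤⇒≤ {S} close)) ⟩
    y ℚ.+ (ι G ℚ.+ ι e) ℚ.+ 1ℚ                   ≡⟨ solve 4 (λ y g e u → y :+ (g :+ e) :+ u := g :+ (y :+ (u :+ e))) refl y (ι G) (ι e) 1ℚ ⟩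
    ι G ℚ.+ (y ℚ.+ ι (suc e))                    ∎)

-- The grid point of a chain and its near-optimal sequence

Eventually : (ℕ → Set) → Set
Eventually Q = ∃[ N ] (∀ n → N ≤ n → Q n)

eventually-× : ∀ {Q R : ℕ → Set} → Eventually Q → Eventually R → Eventually (λ n → Q n × R n)
eventually-× (N , q) (M , r) = N ⊔ M , λ n h → q n (ℕ.m⊔n≤o⇒m≤o N M h) , r n (ℕ.m⊔n≤o⇒n≤o N M h)

eventually-∀ : ∀ {m} {Q : Fin m → ℕ → Set} → (∀ i → Eventually (Q i)) → Eventually (λ n → ∀ i → Q i n)
eventually-∀ {zero}      _  = 0 , λ _ _ ()
eventually-∀ {suc m} {Q} ev = proj₁ both , λ where
    n h zero    → proj₁ (proj₂ both n h)
    n h (suc i) → proj₂ (proj₂ both n h) i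
  where both = eventually-× {Q zero} (ev zero) (eventually-∀ (ev ∘ suc))

-- There are finitely many sequences of a given length, so one index serves for the comparison with
-- all of them.
eventually-∀Vec : ∀ {k m} {Q : Vec (Fin k) m → ℕ → Set} → (∀ v → Eventually (Q v)) → Eventually (λ n → ∀ v → Q v n)
eventually-∀Vec {m = zero} ev = proj₁ (ev []) , λ { n h [] → proj₂ (ev []) n h }
eventually-∀Vec {m = suc m} {Q} ev = proj₁ all , λ { n h (x ∷ v) → proj₂ all n h x v }
  where all = eventually-∀ {Q = λ x n → ∀ v → Q (x ∷ v) n} (λ x → eventually-∀Vec (λ v → ev (x ∷ v)))

parameters : ∀ {k} → MarkovChain k → ℕ → Cell k → ℚ
parameters M m (r , j) = approx (prob (simplexPoint M r) j) m

approx-∑ : ∀ {m} (f : Fin m → ℝ) n → approx (Vector.foldr ℝ._+_ 0ℝ f) n ≡ ∑ℚ (λ j → approx (f j) n)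
approx-∑ {zero}  f n = refl
approx-∑ {suc m} f n = cong (approx (f zero) n ℚ.+_) (approx-∑ (f ∘ suc) n)

approx-Pr : ∀ {k n} (M : MarkovChain k) (t : Sequence k n) m → approx (Pr M t) m ≡ prodℚ (parameters M m) (cells t)
approx-Pr M t m = cong (parameters M m (zero , head t) ℚ.*_) (go (transitions t))
  where
  open MarkovChain M using (p)
  go : ∀ es → approx (List.foldr ℝ._*_ 1ℝ (map (uncurry p) es)) m ≡ prodℚ (parameters M m) (transitionCells es)
  go []       = refl
  go (e ∷ es) = cong (parameters M m (map₁ suc e) ℚ.*_) (go es)

freeRow : ∀ {k N} → (Fin (dim (suc (suc k))) → Fin (suc (suc N))) → Fin (suc (suc (suc k))) → Fin (suc k) → ℕ
freeRow g r c = toℕ (g (combine r c))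

-- Column 0 is the complement of the free columns; subtraction is truncated.
gridWeight : ∀ {k} N → (Fin (dim (suc (suc k))) → Fin (suc (suc N))) → Cell (suc (suc k)) → ℕ
gridWeight N g (r , zero)  = suc N ∸ ∑ (freeRow g r)
gridWeight N g (r , suc c) = freeRow g r c

gridWeight≤ : ∀ {k} N (g : Fin (dim (suc (suc k))) → Fin (suc (suc N))) c → gridWeight N g c ≤ suc N
gridWeight≤ N g (r , zero)  = ℕ.m∸n≤m (suc N) (∑ (freeRow g r))
gridWeight≤ N g (r , suc c) = ℕ.≤-pred (Fin.toℕ<n (g (combine r c)))

-- Only an inequality: where the free entries sum to more than `suc N`, truncation leaves 0 in
-- column 0.
gridWeight-rows : ∀ {k} N (g : Fin (dim (suc (suc k))) → Fin (suc (suc N))) r → suc N ≤ ∑ (λ j → gridWeight N g (r , j))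
gridWeight-rows N g r = ℕ.≤-trans (ℕ.m≤n+m∸n (suc N) G) (ℕ.≤-reflexive (ℕ.+-comm G (suc N ∸ G)))
  where G = ∑ (freeRow g r)

-- The error in column 0: each of the `suc k` free columns is off by at most `3 + k`, and the
-- normalisation of the row adds 1. The free columns stay within this bound as well.
roundingError : ℕ → ℕ
roundingError k = suc (suc k * suc (suc (suc k)))

slack : ℕ → ℕ → ℕ
slack k n = suc (2 * productError (roundingError k) (suc n))

module _ {k n : ℕ} (M : MarkovChain (suc (suc k))) (s : Sequence (suc (suc k)) n) (viterbi : IsViterbiPath M s)
  {x : Vector ℝ (dim (suc (suc k)))} (M≈x : ∀ i → coordinates M i ℝ.≈ x i) (N : ℕ) where
  private
    κ P : ℕ
    κ = suc (suc k)
    P = suc N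
    h : ℚ
    h = mesh N

    NonNegative Normalised Optimal Settled CloseToX : ℕ → Set
    NonNegative m = ∀ r j → 0ℚ ℚ.≤ parameters M m (r , j) ℚ.+ h
    Normalised m = ∀ r → ℚ.∣ ∑ℚ (λ j → parameters M m (r , j)) ℚ.- 1ℚ ∣ ℚ.≤ h
    Optimal m = ∀ (t : Sequence κ n) → prodℚ (parameters M m) (cells t) ℚ.≤ prodℚ (parameters M m) (cells s) ℚ.+ h
    Settled m = ∀ i n → m ≤ n → ℚ.∣ approx (coordinates M i) m ℚ.- approx (coordinates M i) n ∣ ℚ.≤ h
    CloseToX m = ∀ i n → m ≤ n → ℚ.∣ approx (coordinates M i) n ℚ.- approx (x i) n ∣ ℚ.≤ h

    nonNegative : Eventually NonNegative
    nonNegative = eventually-∀ {Q = λ r m → ∀ j → 0ℚ ℚ.≤ parameters M m (r , j) ℚ.+ h} λ r →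
      eventually-∀ {Q = λ j m → 0ℚ ℚ.≤ parameters M m (r , j) ℚ.+ h} λ j →
      Distribution.nonNegative (simplexPoint M r) j h (0<mesh N)

    normalised : Eventually Normalised
    normalised = eventually-∀ {Q = λ r m → ℚ.∣ ∑ℚ (λ j → parameters M m (r , j)) ℚ.- 1ℚ ∣ ℚ.≤ h} λ r →
      let m₀ , H = Distribution.normalised (simplexPoint M r) h (0<mesh N) in
      m₀ , λ m m₀≤ → subst (λ z → ℚ.∣ z ℚ.- 1ℚ ∣ ℚ.≤ h) (approx-∑ (prob (simplexPoint M r)) m) (H m m₀≤)

    optimality : Eventually Optimal
    optimality = eventually-∀Vec {Q = λ t m → prodℚ (parameters M m) (cells t) ℚ.≤ prodℚ (parameters M m) (cells s) ℚ.+ h} λ t →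
      let m₀ , H = viterbi t h (0<mesh N) in
      m₀ , λ m m₀≤ → subst₂ (λ a b → a ℚ.≤ b ℚ.+ h) (approx-Pr M t m) (approx-Pr M s m) (H m m₀≤)

    settling : Eventually Settled
    settling = eventually-∀ {Q = λ i m → ∀ n → m ≤ n → ℚ.∣ approx (coordinates M i) m ℚ.- approx (coordinates M i) n ∣ ℚ.≤ h} λ i →
      let m₀ , H = cauchy (coordinates M i) h (0<mesh N) in
      m₀ , λ m m₀≤ n m≤n → H m n m₀≤ (ℕ.≤-trans m₀≤ m≤n)

    closeness : Eventually CloseToX
    closeness = eventually-∀ {Q = λ i m → ∀ n → m ≤ n → ℚ.∣ approx (coordinates M i) n ℚ.- approx (x i) n ∣ ℚ.≤ h} λ i →
      let m₀ , H = M≈x i h (0<mesh N) in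
      m₀ , λ m m₀≤ n m≤n → H n (ℕ.≤-trans m₀≤ m≤n)

    -- At one index all conditions on the chain hold up to `mesh N`; from here on its parameters are
    -- the rational numbers at that index.
    good : Eventually (λ m → NonNegative m × Normalised m × Optimal m × Settled m × CloseToX m)
    good = eventually-× nonNegative (eventually-× normalised (eventually-× optimality (eventually-× settling closeness)))

    m : ℕ
    m = proj₁ good

    goodₘ : NonNegative m × Normalised m × Optimal m × Settled m × CloseToX m
    goodₘ = proj₂ good m ℕ.≤-refl

    q : Cell κ → ℚ
    q = parameters M m

    q≥ : NonNegative m
    q≥ = proj₁ goodₘ
    rows : Normalised m
    rows = proj₁ (proj₂ goodₘ)
    optimal : Optimal m
    optimal = proj₁ (proj₂ (proj₂ goodₘ))
    settled : Settled m
    settled = proj₁ (proj₂ (proj₂ (proj₂ goodₘ)))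
    close-x : CloseToX m
    close-x = proj₂ (proj₂ (proj₂ (proj₂ goodₘ)))

    ỹ : Cell κ → ℚ
    ỹ c = ι P ℚ.* q c

    y≥ : ∀ r j → 0ℚ ℚ.≤ ỹ (r , j) ℚ.+ 1ℚ
    y≥ r j = begin
      0ℚ                                       ≤⟨ 0≤* (0≤ι P) (q≥ r j) ⟩
      ι P ℚ.* (q (r , j) ℚ.+ h)                ≡⟨ ℚ.*-distribˡ-+ (ι P) (q (r , j)) h ⟩
      ỹ (r , j) ℚ.+ ι P ℚ.* h                  ≡⟨ cong (ỹ (r , j) ℚ.+_) (ι-mesh N) ⟩
      ỹ (r , j) ℚ.+ 1ℚ                         ∎
      where open ℚ.≤-Reasoning

    y-rows : ∀ r → ℚ.∣ ∑ℚ (λ j → ỹ (r , j)) ℚ.- ι P ∣ ℚ.≤ 1ℚ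
    y-rows r = begin
      ℚ.∣ ∑ℚ (λ j → ỹ (r , j)) ℚ.- ι P ∣       ≡⟨ cong (λ z → ℚ.∣ z ℚ.- ι P ∣) (∑ℚ-scale (ι P) (λ j → q (r , j))) ⟩
      ℚ.∣ ι P ℚ.* Q ℚ.- ι P ∣                  ≡⟨ cong ℚ.∣_∣ (solve 2 (λ p q → p :* q :- p := p :* (q :- con 1ℚ)) refl (ι P) Q) ⟩
      ℚ.∣ ι P ℚ.* (Q ℚ.- 1ℚ) ∣                 ≡⟨ trans (ℚ.∣p*q∣≡∣p∣*∣q∣ (ι P) (Q ℚ.- 1ℚ)) (cong (ℚ._* ℚ.∣ Q ℚ.- 1ℚ ∣) (ℚ.0≤p⇒∣p∣≡p (0≤ι P))) ⟩
      ι P ℚ.* ℚ.∣ Q ℚ.- 1ℚ ∣                   ≤⟨ *-monoˡ-≤ (0≤ι P) (rows r) ⟩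
      ι P ℚ.* h                                ≡⟨ ι-mesh N ⟩
      1ℚ                                       ∎
      where
      open ℚ.≤-Reasoning
      open ℚ-Solver
      Q = ∑ℚ (λ j → q (r , j))

    y≤ : ∀ r j → ỹ (r , j) ℚ.≤ ι P ℚ.+ ι (suc κ)
    y≤ r j = begin
      ỹ (r , j)                                ≤⟨ term≤∑ℚ+ {f = λ j → ỹ (r , j)} (y≥ r) j ⟩
      ∑ℚ (λ j → ỹ (r , j)) ℚ.+ ι κ             ≤⟨ ℚ.+-monoˡ-≤ (ι κ) (∣-∣≤⇒≤ {∑ℚ (λ j → ỹ (r , j))} (y-rows r)) ⟩
      ι P ℚ.+ 1ℚ ℚ.+ ι κ                       ≡⟨ ℚ.+-assoc (ι P) 1ℚ (ι κ) ⟩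
      ι P ℚ.+ ι (suc κ)                        ∎
      where open ℚ.≤-Reasoning

    rounded : ∀ r j → ∃[ g ] (g ≤ P × ℚ.∣ ỹ (r , j) ℚ.- ι g ∣ ℚ.≤ ι (suc κ))
    rounded r j = round κ P (ỹ (r , j)) (y≥ r j) (y≤ r j)

    cellOf : Fin (dim κ) → Cell κ
    cellOf i = proj₁ (remQuot {suc κ} (suc k) i) , suc (proj₂ (remQuot {suc κ} (suc k) i))

  gridPoint : Fin (dim κ) → Fin (suc (suc N))
  gridPoint i = fromℕ< (s≤s (proj₁ (proj₂ (uncurry rounded (cellOf i)))))

  private
    gridPoint-close : ∀ i → ℚ.∣ ỹ (cellOf i) ℚ.- ι (toℕ (gridPoint i)) ∣ ℚ.≤ ι (suc κ)
    gridPoint-close i = subst (λ g → ℚ.∣ ỹ (cellOf i) ℚ.- ι g ∣ ℚ.≤ ι (suc κ)) (sym (Fin.toℕ-fromℕ< (s≤s (proj₁ (proj₂ (uncurry rounded (cellOf i)))))))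
      (proj₂ (proj₂ (uncurry rounded (cellOf i))))

    free-close : ∀ r c → ℚ.∣ ỹ (r , suc c) ℚ.- ι (toℕ (gridPoint (combine r c))) ∣ ℚ.≤ ι (suc κ)
    free-close r c = subst (λ cell → ℚ.∣ ỹ cell ℚ.- ι (toℕ (gridPoint (combine r c))) ∣ ℚ.≤ ι (suc κ))
      (cong (λ rc → proj₁ rc , suc (proj₂ rc)) (Fin.remQuot-combine r c)) (gridPoint-close (combine r c))

    weight-close : ∀ c → ℚ.∣ ỹ c ℚ.- ι (gridWeight N gridPoint c) ∣ ℚ.≤ ι (roundingError k)
    weight-close (r , zero)  = complement-close {ỹ (r , zero)} {∑ℚ (λ c → ỹ (r , suc c))} {P}
      {∑ (freeRow gridPoint r)} {suc k * suc κ} (y-rows r)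
      (∑-close {r = suc κ} {λ c → ỹ (r , suc c)} {freeRow gridPoint r} (free-close r)) (y≥ r zero)
    weight-close (r , suc c) = ℚ.≤-trans (free-close r c) (ι-mono-≤ {suc κ} {roundingError k} (ℕ.m≤n⇒m≤1+n (ℕ.m≤n*m (suc κ) (suc k))))

  gridPoint-nearOptimal : ∀ (t : Sequence κ n) →
    weight (gridWeight N gridPoint) (cells t) ≤ weight (gridWeight N gridPoint) (cells s) + slack k n * suc N ^ n
  gridPoint-nearOptimal t = nearOptimal-scaled {q = q} {gridWeight N gridPoint} {roundingError k} {N} {n} weight-close (gridWeight≤ N gridPoint)
    {cells t} {cells s} (length-cells t) (length-cells s) (optimal t)

  -- `suc κ` steps pay for the rounding, one for passing from the index `m` to later ones, and one
  -- because the coordinates of `M` are only `≈` to `x`.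
  gridPoint-near : ∀ {K} → 2 + suc κ ≤ K → ∀ i → NearGrid N K (x i) (toℕ (gridPoint i))
  gridPoint-near {K} K≥ i =
      (λ ε 0<ε → m , λ n m≤n → ℚ.≤-trans {gridLower N K (toℕ (gridPoint i))} (lower n m≤n) (≤+ (approx (x i) n) (ℚ.<⇒≤ 0<ε)))
    , (λ ε 0<ε → m , λ n m≤n → ℚ.≤-trans (upper n m≤n) (≤+ (gridUpper N K (toℕ (gridPoint i))) (ℚ.<⇒≤ 0<ε)))
    where
    open ℚ.≤-Reasoning
    open ℚ-Solver
    g r qᵢ : ℚ
    g = ι (toℕ (gridPoint i))
    r = ι (suc κ)
    qᵢ = q (cellOf i)
    yh : ỹ (cellOf i) ℚ.* h ≡ qᵢ
    yh = trans (solve 3 (λ p q h → p :* q :* h := p :* h :* q) refl (ι P) qᵢ h) (trans (cong (ℚ._* qᵢ) (ι-mesh N)) (ℚ.*-identityˡ qᵢ))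
    c≤x : ∀ n → m ≤ n → qᵢ ℚ.≤ approx (x i) n ℚ.+ h ℚ.+ h
    c≤x n m≤n = ℚ.≤-trans (∣-∣≤⇒≤ {qᵢ} (settled i n m≤n)) (ℚ.+-monoˡ-≤ h (∣-∣≤⇒≤ {approx (coordinates M i) n} {approx (x i) n} (close-x i n m≤n)))
    x≤c : ∀ n → m ≤ n → approx (x i) n ℚ.≤ qᵢ ℚ.+ h ℚ.+ h
    x≤c n m≤n = ℚ.≤-trans (∣-∣≤⇒≥ {approx (coordinates M i) n} {approx (x i) n} (close-x i n m≤n)) (ℚ.+-monoˡ-≤ h (∣-∣≤⇒≥ {qᵢ} (settled i n m≤n)))
    K≥′ : 1ℚ ℚ.+ (1ℚ ℚ.+ r) ℚ.≤ ι K
    K≥′ = ι-mono-≤ {2 + suc κ} K≥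
    lower : ∀ n → m ≤ n → gridLower N K (toℕ (gridPoint i)) ℚ.≤ approx (x i) n
    lower n m≤n = begin
      (g ℚ.- ι K) ℚ.* h                                      ≤⟨ *-monoʳ-≤ (0≤mesh N) (ℚ.+-mono-≤ (∣-∣≤⇒≥ {ỹ (cellOf i)} (gridPoint-close i)) (ℚ.neg-antimono-≤ K≥′)) ⟩
      (ỹ (cellOf i) ℚ.+ r ℚ.- (1ℚ ℚ.+ (1ℚ ℚ.+ r))) ℚ.* h     ≡⟨ solve 3 (λ y r h → (y :+ r :- (con 1ℚ :+ (con 1ℚ :+ r))) :* h := y :* h :- h :- h) refl (ỹ (cellOf i)) r h ⟩
      ỹ (cellOf i) ℚ.* h ℚ.- h ℚ.- h                         ≡⟨ cong (λ z → z ℚ.- h ℚ.- h) yh ⟩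
      qᵢ ℚ.- h ℚ.- h                                          ≤⟨ ℚ.+-monoˡ-≤ (ℚ.- h) (ℚ.+-monoˡ-≤ (ℚ.- h) (c≤x n m≤n)) ⟩
      approx (x i) n ℚ.+ h ℚ.+ h ℚ.- h ℚ.- h                 ≡⟨ solve 2 (λ x h → x :+ h :+ h :- h :- h := x) refl (approx (x i) n) h ⟩
      approx (x i) n                                         ∎
    upper : ∀ n → m ≤ n → approx (x i) n ℚ.≤ gridUpper N K (toℕ (gridPoint i))
    upper n m≤n = begin
      approx (x i) n                                         ≤⟨ x≤c n m≤n ⟩
      qᵢ ℚ.+ h ℚ.+ h                                          ≡⟨ cong (λ z → z ℚ.+ h ℚ.+ h) yh ⟨
      ỹ (cellOf i) ℚ.* h ℚ.+ h ℚ.+ h                         ≡⟨ solve 2 (λ y h → y :* h :+ h :+ h := (y :+ (con 1ℚ :+ con 1ℚ)) :* h) refl (ỹ (cellOf i)) h ⟩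
      (ỹ (cellOf i) ℚ.+ (1ℚ ℚ.+ 1ℚ)) ℚ.* h                   ≤⟨ *-monoʳ-≤ (0≤mesh N) (ℚ.+-monoˡ-≤ (1ℚ ℚ.+ 1ℚ) (∣-∣≤⇒≤ {ỹ (cellOf i)} (gridPoint-close i))) ⟩
      (g ℚ.+ r ℚ.+ (1ℚ ℚ.+ 1ℚ)) ℚ.* h                        ≡⟨ cong (ℚ._* h) (solve 3 (λ g r u → g :+ r :+ (u :+ u) := g :+ (u :+ (u :+ r))) refl g r 1ℚ) ⟩
      (g ℚ.+ (1ℚ ℚ.+ (1ℚ ℚ.+ r))) ℚ.* h                      ≤⟨ *-monoʳ-≤ (0≤mesh N) (ℚ.+-monoʳ-≤ g K≥′) ⟩
      (g ℚ.+ ι K) ℚ.* h                                      ∎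

-- Moving a single grid coordinate

∑-cong : ∀ {m} {f f′ : Fin m → ℕ} → f ≗ f′ → ∑ f ≡ ∑ f′
∑-cong {zero}  eq = refl
∑-cong {suc m} eq = cong₂ _+_ (eq zero) (∑-cong (eq ∘ suc))

∑-shift : ∀ {m τ} {f f′ : Fin m → ℕ} c → (∀ i → i ≢ c → f i ≡ f′ i) → f c ≡ f′ c + τ → ∑ f ≡ ∑ f′ + τ
∑-shift {suc m} {τ} {f} {f′} zero eq shift = begin
  f zero + ∑ (f ∘ suc)              ≡⟨ cong₂ _+_ shift (∑-cong λ i → eq (suc i) λ ()) ⟩
  f′ zero + τ + ∑ (f′ ∘ suc)        ≡⟨ ℕ.+-assoc (f′ zero) τ _ ⟩
  f′ zero + (τ + ∑ (f′ ∘ suc))      ≡⟨ cong (f′ zero +_) (ℕ.+-comm τ _) ⟩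
  f′ zero + (∑ (f′ ∘ suc) + τ)      ≡⟨ ℕ.+-assoc (f′ zero) _ τ ⟨
  f′ zero + ∑ (f′ ∘ suc) + τ        ∎
  where open ≡-Reasoning
∑-shift {suc m} {τ} {f} {f′} (suc c) eq shift = trans
  (cong₂ _+_ (eq zero λ ()) (∑-shift c (λ i i≢c → eq (suc i) (i≢c ∘ Fin.suc-injective)) shift))
  (sym (ℕ.+-assoc (f′ zero) (∑ (f′ ∘ suc)) τ))

gridWeight-cong : ∀ {k N} {g g′ : Fin (dim (suc (suc k))) → Fin (suc (suc N))} → g ≗ g′ → gridWeight N g ≗ gridWeight N g′
gridWeight-cong {N = N} {g} {g′} eq (r , zero) = cong (suc N ∸_)
  (∑-cong {f = freeRow g r} {freeRow g′ r} λ c → cong toℕ (eq (combine r c)))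
gridWeight-cong eq (r , suc c) = cong toℕ (eq (combine r c))

-- If (r , j) is the only cell of X in row r and is not in Y, then the weights of X and Y
-- move in opposite directions along this coordinate of row r; column 0 is not a coordinate.
monotoneColumn : ∀ {k} → Fin (suc (suc k)) → Fin (suc k)
monotoneColumn zero    = zero
monotoneColumn (suc c) = c

module Shift {k N : ℕ} {g g′ : Fin (dim (suc (suc k))) → Fin (suc (suc N))} {r : Fin (suc (suc (suc k)))} {c : Fin (suc k)} {τ : ℕ}
  (agree : ∀ i → i ≢ combine r c → g i ≡ g′ i) (shift : freeRow g r c ≡ freeRow g′ r c + τ) where

  V W : Cell (suc (suc k)) → ℕ
  V = gridWeight N g
  W = gridWeight N g′

  agree-row : ∀ {r′} → r′ ≢ r → ∀ c′ → freeRow g r′ c′ ≡ freeRow g′ r′ c′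
  agree-row r′≢r c′ = cong toℕ (agree _ (r′≢r ∘ Fin.combine-injectiveˡ _ c′ r c))

  agree-column : ∀ c′ → c′ ≢ c → freeRow g r c′ ≡ freeRow g′ r c′
  agree-column c′ c′≢c = cong toℕ (agree _ (c′≢c ∘ Fin.combine-injectiveʳ r c′ r c))

  otherRow : ∀ {r′} → r′ ≢ r → ∀ j′ → V (r′ , j′) ≡ W (r′ , j′)
  otherRow r′≢r zero     = cong (suc N ∸_) (∑-cong (agree-row r′≢r))
  otherRow r′≢r (suc c′) = agree-row r′≢r c′

  column₀ : V (r , zero) ≤ W (r , zero)
  column₀ = ℕ.∸-monoʳ-≤ (suc N) (ℕ.≤-trans (ℕ.m≤m+n _ τ) (ℕ.≤-reflexive (sym (∑-shift c agree-column shift))))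

  -- Truncation could swallow part of the shift `τ`; an entry that is still positive at `g` shows
  -- that the subtraction was exact.
  column₀-shift : 0 < V (r , zero) → V (r , zero) + τ ≤ W (r , zero)
  column₀-shift 0<V = begin
    V (r , zero) + τ                                ≡⟨ cong (λ z → suc N ∸ z + τ) sum≡ ⟩
    suc N ∸ (G + τ) + τ                             ≡⟨ cong (_+ τ) (ℕ.∸-+-assoc (suc N) G τ) ⟨
    suc N ∸ G ∸ τ + τ                               ≡⟨ ℕ.m∸n+n≡m τ≤ ⟩
    W (r , zero)                                    ∎
    where
    open ≤-Reasoning
    G : ℕ
    G = ∑ (freeRow g′ r)
    sum≡ : ∑ (freeRow g r) ≡ G + τ
    sum≡ = ∑-shift c agree-column shift
    τ≤ : τ ≤ suc N ∸ G
    τ≤ = ℕ.<⇒≤ (ℕ.m∸n≢0⇒n<m (ℕ.m<n⇒n≢0 (subst (0 <_) (trans (cong (suc N ∸_) sum≡) (sym (ℕ.∸-+-assoc (suc N) G τ))) 0<V)))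

  otherColumn : ∀ c′ → W (r , suc c′) ≤ V (r , suc c′)
  otherColumn c′ with c′ Fin.≟ c
  ... | yes refl = ℕ.≤-trans (ℕ.m≤m+n _ τ) (ℕ.≤-reflexive (sym shift))
  ... | no  c′≢c = ℕ.≤-reflexive (sym (agree-column c′ c′≢c))

module _ {k N D L : ℕ} {X Y : List (Cell (suc (suc k)))}
  {r : Fin (suc (suc (suc k)))} {j : Fin (suc (suc k))} (e∈X : (r , j) ∈ X)
  (alone : ∀ {j′} → (r , j′) ∈ X → j′ ≡ j) (e∉Y : (r , j) ∉ Y) where

  τ-bound : ℕ
  τ-bound = D ^ pred (length X) * (L + L)

  nearTie-grid-separated : {g g′ : Fin (dim (suc (suc k))) → Fin (suc (suc N))} →
    NearTie (suc N) D L X Y (gridWeight N g) → NearTie (suc N) D L X Y (gridWeight N g′) →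
    (∀ i → i ≢ combine r (monotoneColumn j) → g i ≡ g′ i) →
    freeRow g r (monotoneColumn j) ≤ freeRow g′ r (monotoneColumn j) + τ-bound
  nearTie-grid-separated {g} {g′} tie tie′ agree with ℕ.≤-total (freeRow g r (monotoneColumn j)) (freeRow g′ r (monotoneColumn j))
  ... | inj₁ g≤g′ = ℕ.≤-trans g≤g′ (ℕ.m≤m+n _ τ-bound)
  ... | inj₂ g′≤g with τ , eq ← ℕ.m≤n⇒∃[o]m+o≡n g′≤g =
    ℕ.≤-trans (ℕ.≤-reflexive (sym eq)) (ℕ.+-monoʳ-≤ (freeRow g′ r (monotoneColumn j)) (bound j refl))
    where
    module S = Shift {g = g} {g′} {r} {monotoneColumn j} {τ} agree (sym eq)
    bound : ∀ j′ → j′ ≡ j → τ ≤ τ-bound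
    -- Column 0 falls as the coordinate rises, so here `g′` has the larger weight on `X` and `g` the
    -- smaller. The lower bound on the factors of `X` supplies the positivity that excludes
    -- truncation.
    bound zero refl = nearTie-separated tie tie′ (All.tabulate X≤) (All.tabulate Y≤) e∈X
        (S.column₀-shift (positive (All.lookup (NearTie.large tie) e∈X)))
      where
      positive : ∀ {w} → suc N ≤ D * w → 0 < w
      positive {zero}  h = contradiction (ℕ.≤-trans h (ℕ.≤-reflexive (ℕ.*-zeroʳ D))) λ ()
      positive {suc w} h = s≤s z≤n
      X≤ : ∀ {cell} → cell ∈ X → gridWeight N g cell ≤ gridWeight N g′ cell
      X≤ {r′ , j′} cell∈ with r′ Fin.≟ r
      ... | no  r′≢r = ℕ.≤-reflexive (S.otherRow r′≢r j′)
      ... | yes refl with refl ← alone cell∈ = S.column₀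
      Y≤ : ∀ {cell} → cell ∈ Y → gridWeight N g′ cell ≤ gridWeight N g cell
      Y≤ {r′ , j′} cell∈ with r′ Fin.≟ r
      ... | no  r′≢r = ℕ.≤-reflexive (sym (S.otherRow r′≢r j′))
      Y≤ {r′ , zero}   cell∈ | yes refl = contradiction cell∈ e∉Y
      Y≤ {r′ , suc c′} cell∈ | yes refl = S.otherColumn c′
    bound (suc c) refl = nearTie-separated tie′ tie (All.tabulate X≤) (All.tabulate Y≤) e∈X (ℕ.≤-reflexive eq)
      where
      X≤ : ∀ {cell} → cell ∈ X → gridWeight N g′ cell ≤ gridWeight N g cell
      X≤ {r′ , j′} cell∈ with r′ Fin.≟ r
      ... | no  r′≢r = ℕ.≤-reflexive (sym (S.otherRow r′≢r j′))
      ... | yes refl with refl ← alone cell∈ = S.otherColumn c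
      Y≤ : ∀ {cell} → cell ∈ Y → gridWeight N g cell ≤ gridWeight N g′ cell
      Y≤ {r′ , j′} cell∈ with r′ Fin.≟ r
      ... | no  r′≢r = ℕ.≤-reflexive (S.otherRow r′≢r j′)
      Y≤ {r′ , zero}   cell∈ | yes refl = S.column₀
      Y≤ {r′ , suc c′} cell∈ | yes refl = ℕ.≤-reflexive (S.agree-column c′ λ { refl → e∉Y cell∈ })

-- Every chain of the region of `M` also has `s` as a Viterbi path, so its grid point is a near tie
-- of `X` and `Y`. By `alone` and `e∉Y`, near ties are bounded along one coordinate, and the region
-- would be null.
swap-null : ∀ {k n} {s s₊ s₋ : Sequence (suc (suc k)) n} {C X Y : List (Cell (suc (suc k)))} →
  cells s ↭ C ++ X ++ Y → cells s₊ ↭ C ++ X ++ X → cells s₋ ↭ C ++ Y ++ Y →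
  length X ≡ length Y → ∀ {r j} → (r , j) ∈ X → (∀ {j′} → (r , j′) ∈ X → j′ ≡ j) → (r , j) ∉ Y →
  ¬ IsViterbiSequence s
swap-null {k} {n} {s} {s₊} {s₋} {C} {X} {Y} p p₊ p₋ len {r} {j} e∈X alone e∉Y (M , region , viterbi) =
  approximated-by-graph⇒null (combine r (monotoneColumn j)) K N₀
    (λ N g → NearTie (suc N) D L X Y (gridWeight N g))
    (λ N g → nearTie? (suc N) D L X Y (gridWeight N g))
    (λ g≗g′ → nearTie-resp (gridWeight-cong g≗g′))
    (λ {N} {g} {g′} tie tie′ agree → ℕ.≤-trans (nearTie-grid-separated {N = N} e∈X alone e∉Y {g} {g′} tie tie′ agree)
      (ℕ.+-monoʳ-≤ _ (ℕ.m≤n+m τ (3 + suc (suc k)))))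
    (λ {N} {x} N₀≤ (M′ , same , M′≈x) →
      let viterbi′ = Equivalence.to (same s) viterbi
          g = gridPoint M′ s viterbi′ {x} M′≈x N in
      g
      , nearOptimal⇒nearTie {s = s} (gridWeight-rows N g) (gridPoint-nearOptimal M′ s viterbi′ {x} M′≈x N)
          (ℕ.m≤n⇒m≤1+n N₀≤) (gridWeight≤ N g) {s₊} {s₋} C X Y p p₊ p₋ len
      , gridPoint-near M′ s viterbi′ {x} M′≈x N (ℕ.m≤m+n (3 + suc (suc k)) τ))
    region
  where
  -- `D` is twice the inverse of the greedy lower bound, `L` the error of the tie, `τ` the
  -- separation along a grid line. `K` covers both the approximation of points, `3 + suc (suc k)`,
  -- and the separation. From `N₀` on, the slack is small enough for `N-large`.
  D L τ K N₀ : ℕ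
  D = 2 * suc (suc k) ^ suc n
  L = D * slack k n
  τ = D ^ pred (length X) * (L + L)
  K = 3 + suc (suc k) + τ
  N₀ = 2 * (suc (suc k) ^ suc n * slack k n)

-- Signatures

-- A simple cycle leaves each state at most once, so in the copies of `a` the edge `e` is the only
-- one in its row. If `b` lacked `e`, the exchange of `a` and `b` would meet the hypotheses of
-- `swap-null`.
frequent-⊆ : ∀ {s : Sequence (suc (suc k)) n} (D : Decomposition (head s) (transitions s) z) →
  let open Decomposition D in IsViterbiSequence s →
  ∀ {a b} → a ∈ cycles → b ∈ cycles → suc (suc k) ≤ mult a cycles → suc (suc k) ≤ mult b cycles →
  ∀ {e} → e ∈ a → e ∈ b
frequent-⊆ {k} {s = s} D vit {a} {b} a∈ b∈ ka kb {e} e∈a with Any.any? (e ≟ᵉ_) b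
... | yes e∈b = e∈b
... | no  e∉b = contradiction vit (swap-null {C = rest} {transitionCells (rep (length b) a)} {transitionCells (rep (length a) b)}
    cells-s cells-s₊ cells-s₋ length≡
    (∈-map⁺ lift (∈-rep⁺ (nonempty (All.lookup areCycles b∈)) e∈a)) same-row
    (e∉b ∘ unlift (length a)))
  where
  open Decomposition D
  open IsSimpleCycle using (nonempty; unique-sources)
  a≢b : a ≢ b
  a≢b refl = e∉b e∈a
  open Exchange (frequent-exchange D a∈ b∈ ka kb a≢b)
  lift : Edge (suc (suc k)) → Cell (suc (suc k))
  lift = map₁ suc
  unlift : ∀ m {c} {i j} → (suc i , j) ∈ transitionCells (rep m c) → (i , j) ∈ c
  unlift m m∈ with _ , f∈ , refl ← ∈-map⁻ lift m∈ = ∈-rep⁻ m f∈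
  same-row : ∀ {j′} → (suc (proj₁ e) , j′) ∈ transitionCells (rep (length b) a) → j′ ≡ proj₂ e
  same-row m∈ = cong proj₂ (Unique-map-injective (unique-sources (All.lookup areCycles a∈))
    (unlift (length b) m∈) e∈a refl)
  length≡ : length (transitionCells (rep (length b) a)) ≡ length (transitionCells (rep (length a) b))
  length≡ = begin
    length (transitionCells (rep (length b) a))   ≡⟨ List.length-map lift (rep (length b) a) ⟩
    length (rep (length b) a)                     ≡⟨ length-rep (length b) a ⟩
    length b * length a                           ≡⟨ ℕ.*-comm (length b) (length a) ⟩
    length a * length b                           ≡⟨ length-rep (length a) b ⟨
    length (rep (length a) b)                     ≡⟨ List.length-map lift (rep (length a) b) ⟨
    length (transitionCells (rep (length a) b))   ∎
    where open ≡-Reasoning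

-- Distinct sources make the edges of a simple cycle distinct, so equality as sets of edges is
-- already equality as multisets.
frequent-↭ : ∀ {s : Sequence (suc (suc k)) n} (D : Decomposition (head s) (transitions s) z) →
  let open Decomposition D in IsViterbiSequence s →
  ∀ {a b} → suc (suc k) ≤ mult a cycles → suc (suc k) ≤ mult b cycles → a ↭ b
frequent-↭ {s = s} D vit {a} {b} ka kb = ∼bag⇒↭ (unique∧set⇒bag (unique a∈) (unique b∈)
    (mk⇔ (frequent-⊆ {s = s} D vit a∈ b∈ ka kb) (frequent-⊆ {s = s} D vit b∈ a∈ kb ka)))
  where
  open Decomposition D
  a∈ = mult>0⇒∈ cycles (ℕ.≤-trans z<s ka)
  b∈ = mult>0⇒∈ cycles (ℕ.≤-trans z<s kb)
  unique : ∀ {c} → c ∈ cycles → Unique c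
  unique c∈ = Unique.map⁻ (IsSimpleCycle.unique-sources (All.lookup areCycles c∈))

-- Infrequent cycles have the same multiplicities on both sides; the frequent ones
-- are all the same cycle, whose multiplicity is determined by the length.
truncated-≡⇒↭ : ∀ {s t : Sequence (suc (suc k)) n} {y z}
  (D : Decomposition (head s) (transitions s) y) (E : Decomposition (head t) (transitions t) z) →
  IsViterbiSequence s → Decomposition.core D ≡ Decomposition.core E →
  (∀ {c} → length c ≤ suc (suc k) →
    suc (suc k) ⊓ mult c (Decomposition.cycles D) ≡ suc (suc k) ⊓ mult c (Decomposition.cycles E)) →
  transitions s ↭ transitions t
truncated-≡⇒↭ {k} {n} {s} {t} D E vit core≡ trunc≡ = ↭-trans split-D (↭-trans
    (↭.++⁺ (↭-reflexive core≡) (↭.++⁺ high-↭ low-↭)) (↭-sym split-E))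
  where
  K = suc (suc k)
  module D = Decomposition D
  module E = Decomposition E
  -- Frequency refers to `D` also for the cycles of `E`, since the optimality of `s` speaks about
  -- the cycles of `D`.
  Frequent : List (Edge K) → Set
  Frequent c = K ≤ mult c D.cycles
  frequent? : Decidable Frequent
  frequent? c = K ℕ.≤? mult c D.cycles
  short : ∀ {cs} → All IsSimpleCycle cs → ∀ {c} → c ∈ cs → length c ≤ K
  short Cs c∈ = IsSimpleCycle.length≤ (All.lookup Cs c∈)
  split : ∀ (core : List (Edge K)) cs {es} → es ↭ core ++ concat cs →
    es ↭ core ++ concat (filter frequent? cs) ++ concat (filter (¬? ∘ frequent?) cs)
  split core cs p = ↭-trans p (↭.++⁺ˡ core (↭-trans (concat-↭ (filter-¬filter-↭ frequent? cs))
    (↭-reflexive (sym (List.concat-++ (filter frequent? cs) _)))))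
  split-D = split D.core D.cycles D.edges-↭
  split-E = split E.core E.cycles E.edges-↭

  low-mult : ∀ c → ¬ Frequent c → mult c D.cycles ≡ mult c E.cycles
  low-mult c ¬fc with length c ℕ.≤? K
  ... | yes c≤ = begin
      mult c D.cycles          ≡⟨ ℕ.m≥n⇒m⊓n≡n (ℕ.<⇒≤ (ℕ.≰⇒> ¬fc)) ⟨
      K ⊓ mult c D.cycles      ≡⟨ trunc≡ c≤ ⟩
      K ⊓ mult c E.cycles      ≡⟨ ℕ.m≥n⇒m⊓n≡n E≤ ⟩
      mult c E.cycles          ∎
    where
    open ≡-Reasoning
    -- If `c` reached the threshold in `E`, equality of the truncated values would make it frequent
    -- in `D`.
    E≤ : mult c E.cycles ≤ K
    E≤ with ℕ.≤-total (mult c E.cycles) K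
    ... | inj₁ h = h
    ... | inj₂ h = contradiction (ℕ.m⊓n≡m⇒m≤n (trans (trunc≡ c≤) (ℕ.m≤n⇒m⊓n≡m h))) ¬fc
  ... | no c≰ = trans (absent D.areCycles) (sym (absent E.areCycles))
    where
    absent : ∀ {cs} → All IsSimpleCycle cs → mult c cs ≡ 0
    absent {cs} Cs = ℕ.n≤0⇒n≡0 (ℕ.≮⇒≥ λ h → c≰ (short Cs (mult>0⇒∈ cs h)))

  low-↭ : concat (filter (¬? ∘ frequent?) D.cycles) ↭ concat (filter (¬? ∘ frequent?) E.cycles)
  low-↭ = concat-↭ (mult-≡⇒filter-↭ (¬? ∘ frequent?) D.cycles E.cycles low-mult)

  highD = filter frequent? D.cycles
  highE = filter frequent? E.cycles

  lengths≡ : length (concat highD) ≡ length (concat highE)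
  lengths≡ = ℕ.+-cancelʳ-≡ _ _ _ (begin
      length (concat highD) + length (concat (filter (¬? ∘ frequent?) D.cycles)) ≡⟨ List.length-++ (concat highD) ⟨
      length restD          ≡⟨ ℕ.+-cancelˡ-≡ (length D.core) _ _ total ⟩
      length restE          ≡⟨ List.length-++ (concat highE) ⟩
      length (concat highE) + length (concat (filter (¬? ∘ frequent?) E.cycles)) ≡⟨ cong (length (concat highE) +_) (↭.↭-length low-↭) ⟨
      length (concat highE) + length (concat (filter (¬? ∘ frequent?) D.cycles)) ∎)
    where
    open ≡-Reasoning
    restD = concat highD ++ concat (filter (¬? ∘ frequent?) D.cycles)
    restE = concat highE ++ concat (filter (¬? ∘ frequent?) E.cycles)
    total : length D.core + length restD ≡ length D.core + length restE
    total = begin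
      length D.core + length restD  ≡⟨ List.length-++ D.core ⟨
      length (D.core ++ restD)      ≡⟨ ↭.↭-length split-D ⟨
      length (transitions s)        ≡⟨ trans (length-transitions s) (sym (length-transitions t)) ⟩
      length (transitions t)        ≡⟨ ↭.↭-length split-E ⟩
      length (E.core ++ restE)      ≡⟨ List.length-++ E.core ⟩
      length E.core + length restE  ≡⟨ cong (λ c → length c + length restE) core≡ ⟨
      length D.core + length restE  ∎

  high⇒frequent : ∀ cs {c} → c ∈ filter frequent? cs → Frequent c
  high⇒frequent cs c∈ = proj₂ (∈-filter⁻ frequent? {xs = cs} c∈)

  high-↭ : concat highD ↭ concat highE
  high-↭ = by-cases highD highE lengths≡ (high⇒frequent D.cycles) (high⇒frequent E.cycles)
    λ fc → ∈-filter⁺ frequent? (mult>0⇒∈ D.cycles (ℕ.≤-trans z<s fc)) fc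
    where
    by-cases : ∀ hs hs′ → length (concat hs) ≡ length (concat hs′) →
      (∀ {c} → c ∈ hs → Frequent c) → (∀ {c} → c ∈ hs′ → Frequent c) →
      (∀ {c} → Frequent c → c ∈ hs) → concat hs ↭ concat hs′
    by-cases [] [] _ _ _ _ = ↭-refl
    by-cases [] (c ∷ _) _ _ f′ f⁻ with () ← f⁻ (f′ (here refl))
    by-cases hs@(c ∷ _) hs′ len f f′ _ = ↭-trans hs-↭ (↭-trans (↭-reflexive (cong (λ m → rep m c) same)) (↭-sym hs′-↭))
      where
      hs-↭ : concat hs ↭ rep (length hs) c
      hs-↭ = concat-↭-rep (All.tabulate λ d∈ → frequent-↭ {s = s} D vit (f d∈) (f (here refl)))
      hs′-↭ : concat hs′ ↭ rep (length hs′) c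
      hs′-↭ = concat-↭-rep (All.tabulate λ d∈ → frequent-↭ {s = s} D vit (f′ d∈) (f (here refl)))
      same : length hs ≡ length hs′
      same = ℕ.*-cancelʳ-≡ (length hs) (length hs′) (length c) {{>-nonZero
          (IsSimpleCycle.nonempty (All.lookup D.areCycles (mult>0⇒∈ D.cycles (ℕ.≤-trans z<s (f (here refl))))))}}
        (begin
          length hs * length c          ≡⟨ length-rep (length hs) c ⟨
          length (rep (length hs) c)    ≡⟨ ↭.↭-length hs-↭ ⟨
          length (concat hs)            ≡⟨ len ⟩
          length (concat hs′)           ≡⟨ ↭.↭-length hs′-↭ ⟩
          length (rep (length hs′) c)   ≡⟨ length-rep (length hs′) c ⟩
          length hs′ * length c         ∎)
        where open ≡-Reasoning

allEdges : ∀ k → List (Edge k)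
allEdges k = cartesianProduct (allFin k) (allFin k)

∈-edgeLists : ∀ m {es : List (Edge k)} → length es ≤ m → es ∈ listsUpTo (allEdges k) m
∈-edgeLists {k} m = ∈-listsUpTo m (All.tabulate λ _ → ∈-cartesianProduct⁺ (∈-allFin _) (∈-allFin _))

Signature : ℕ → Set
Signature k = Fin k × List (Edge k) × List ℕ

-- A crude superset: multiplicities are listed for all edge lists of length at most `k`, cycles or
-- not. What matters is that its size depends on `k` alone.
signatures : ∀ k → List (Signature k)
signatures k = cartesianProduct (allFin k) (cartesianProduct (listsUpTo (allEdges k) (k * k))
  (listsUpTo (upTo (suc k)) (length (listsUpTo (allEdges k) k))))

sequenceDecomposition : ∀ (s : Sequence k n) → Decomposition (head s) (transitions s) (proj₁ (sequenceWalk s))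
sequenceDecomposition s = decompose (proj₂ (sequenceWalk s))

signature : Sequence k n → Signature k
signature {k} s = head s , core , map (λ c → k ⊓ mult c cycles) (listsUpTo (allEdges k) k)
  where open Decomposition (sequenceDecomposition s)

signature∈ : ∀ (s : Sequence k n) → signature s ∈ signatures k
signature∈ {k} s = ∈-cartesianProduct⁺ (∈-allFin (head s)) (∈-cartesianProduct⁺
  (∈-edgeLists (k * k) core≤)
  (∈-listsUpTo _ (All.map⁺ (All.tabulate λ _ → ∈-upTo⁺ (s≤s (ℕ.m⊓n≤m k _)))) (ℕ.≤-reflexive (List.length-map _ (listsUpTo (allEdges k) k)))))
  where open Decomposition (sequenceDecomposition s)

signature-≡⇒∼ : ∀ {s t : Sequence (suc (suc k)) n} → IsViterbiSequence s → signature s ≡ signature t → s ∼ t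
signature-≡⇒∼ {k} {s = s} {t} vit eq = cong proj₁ eq ,
  truncated-≡⇒↭ {s = s} {t} (sequenceDecomposition s) (sequenceDecomposition t) vit (cong (proj₁ ∘ proj₂) eq)
    λ c≤ → map-≡⇒≗ _ (cong (proj₂ ∘ proj₂) eq) (∈-edgeLists (suc (suc k)) c≤)

oneState-≡ : ∀ (s t : Vec (Fin 1) n) → s ≡ t
oneState-≡ []          []          = refl
oneState-≡ (zero ∷ s) (zero ∷ t) = cong (zero ∷_) (oneState-≡ s t)

theorem3p5 : ∀ (k : ℕ) → 1 ≤ℕ k → ∃[ C ] (∀ (n : ℕ) → 1 ≤ℕ n → ViterbiSequences#≤ k n C)
-- With one state the parameter space has dimension 0 and offers no coordinate to eliminate, but
-- there is only one sequence of each length.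
theorem3p5 (suc zero) _ = 1 , λ n _ ss vit ≁ →
  codes-bound (λ _ → tt) [ tt ] (λ _ _ → here refl) (λ {s} {t} _ _ _ s≁t → s≁t (subst (s ∼_) (oneState-≡ s t) (refl , ↭-refl))) vit ≁
theorem3p5 k@(suc (suc _)) _ = length (signatures k) , λ n _ ss vit ≁ →
  codes-bound signature (signatures k) (λ s _ → signature∈ s) (λ vs _ eq s≁t → s≁t (signature-≡⇒∼ vs eq)) vit ≁
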